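{- Let $\mathbb{K}$ be an algebraically closed field, let $G=(V,A)$ be a connected simple directed graph on vertices $V=\{1,\dots,n\}$ with $n\geq 3$, assume that the characteristic of $\mathbb{K}$ does not divide $n$, and let $\omega\in\mathbb{K}$ be a primitive $n$-th root of unity. Then $$H_G=\bigcap_{C}H_{G,C},$$ where $C$ ranges over all Hamiltonian cycles of the graph $G$, $H_G$ is the Hamiltonian ideal of $G$ and $H_{G,C}$ is the cycle ideal of $C$, all in $\mathbb{K}[x_1,\dots,x_n]$ (an empty intersection being the whole ring).
   Context: Simple directed graph: no loops, no repeated arcs (both $(i,j)$ and $(j,i)$ may be present). $\delta^+(i)$ is the set of vertices $j$ with $(i,j)\in A$. The Hamiltonian ideal $H_G\subseteq\mathbb{K}[x_1,\dots,x_n]$ is generated by the polynomials $x_i^n-1$ and $\prod_{j\in\delta^+(i)}(\omega x_i-x_j)$ for $i\in V$ (an empty product is $1$). A cycle of length $k>2$ in $G$ is a set of arcs $C=\{(v_1,v_2),(v_2,v_3),\dots,(v_k,v_1)\}\subseteq A$ with $v_1,\dots,v_k$ distinct; it is Hamiltonian if $k=n$. $C$ is called doubly covered if consecutive vertices of $C$ are joined by arcs of $G$ in both directions; otherwise $C$ is called directed. Cycle ideal: for a cycle $C$ of length $k$ with vertices $v_1,\dots,v_k$ in cyclic order and $\omega$ a primitive $k$-th root of unity, $H_{G,C}=\langle g_1,\dots,g_k\rangle\subseteq\mathbb{K}[x_{v_1},\dots,x_{v_k}]$, where: - if $C$ is doubly covered, $g_i=x_{v_i}+\frac{\omega^{2+i}-\omega^{2-i}}{\omega^3-\omega}x_{v_{k-1}}+\frac{\omega^{1-i}-\omega^{3+i}}{\omega^3-\omega}x_{v_k}$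 for $1\le i\le k-2$, $g_{k-1}=(x_{v_{k-1}}-\omega x_{v_k})(x_{v_{k-1}}-\omega^{ -1}x_{v_k})$, and $g_k=x_{v_k}^k-1$; - if $C$ is directed, $g_i=x_{v_{k-i}}-\omega^{k-i}x_{v_k}$ for $1\le i\le k-1$, and $g_k=x_{v_k}^k-1$. For a Hamiltonian cycle, $k=n$ and the polynomial ring is $\mathbb{K}[x_1,\dots,x_n]$. -}

module Defs where

open import Level using (Level; _⊔_; 0ℓ)
open import Algebra.Bundles using (CommutativeRing; RawRing; Semiring)
open import Algebra.Apartness.Bundles using (HeytingCommutativeRing; HeytingField)
import Algebra.Apartness.Properties.HeytingCommutativeRing as HeytingProperties
open import Algebra.Definitions using (Invertible)
import Algebra.Definitions.RawSemiring as RawSemiringDefinitions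
import Algebra.Properties.Ring as RingProperties
open import Data.Bool.Base using (if_then_else_)
open import Data.Fin.Base using (Fin; toℕ; fromℕ)
open import Data.Fin.Properties using () renaming (_≟_ to _≟ᶠ_)
open import Data.Integer.Base using (ℤ; +_; -[1+_]) renaming (_+_ to _+ᶻ_; _-_ to _-ᶻ_)
open import Data.List.Base using (List; []; _∷_; [_]; _++_; map; foldr; filter; allFin; cartesianProductWith)
open import Data.Nat.Base using (ℕ; zero; suc; _≤_; _<_; _∸_; z≤n; s≤s; >-nonZero) renaming (_+_ to _+ᴺ_)
open import Data.Nat.Divisibility using (_∣_)
open import Data.Nat.DivMod using (_mod_)
open import Data.Nat.Properties using (<-trans) renaming (_≟_ to _≟ᴺ_)
open import Data.Product.Base using (_×_; _,_; proj₁; proj₂; ∃)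
open import Data.Vec.Base using (Vec; replicate; tabulate; zipWith)
open import Data.Vec.Functional using (Vector)
open import Data.Vec.Properties using (≡-dec)
open import Function.Bundles using (_⇔_)
open import Function.Definitions using (Injective)
open import Relation.Binary.Construct.Closure.Equivalence using (EqClosure)
open import Relation.Binary.Core using (Rel)
open import Relation.Binary.Definitions using (Decidable)
open import Relation.Binary.PropositionalEquality.Core using (_≡_)
import Relation.Binary.Reasoning.Setoid as SetoidReasoning
open import Relation.Nullary.Decidable.Core using (does)
open import Relation.Nullary.Negation.Core using (¬_)
open import Relation.Unary using (Pred)

-- A polynomial in n variables is a finite formal sum of terms (c , e)
-- standing for c · x₁^e₁ ⋯ xₙ^eₙ.  The same monomial may occur several
-- times; polynomials are compared by their total coefficients.

module Polynomials {c ℓ} (R : CommutativeRing c ℓ) (n : ℕ) where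

  private module R = CommutativeRing R

  Monomial : Set
  Monomial = Vec ℕ n

  Term : Set c
  Term = R.Carrier × Monomial

  Poly : Set c
  Poly = List Term

  coeff : Poly → Monomial → R.Carrier
  coeff []            m = R.0#
  coeff ((a , e) ∷ p) m = (if does (≡-dec _≟ᴺ_ e m) then a else R.0#) R.+ coeff p m

  infix 4 _≈ₚ_
  record _≈ₚ_ (p q : Poly) : Set ℓ where
    constructor mk≈ₚ
    field
      coeff-≈ : ∀ m → coeff p m R.≈ coeff q m

  const : R.Carrier → Poly
  const a = [ (a , replicate n 0) ]

  X : Fin n → Poly
  X i = [ (R.1# , tabulate (λ j → if does (i ≟ᶠ j) then 1 else 0)) ]

  mulTerm : Term → Term → Term
  mulTerm (a , e) (b , f) = a R.* b , zipWith _+ᴺ_ e f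

  negTerm : Term → Term
  negTerm (a , e) = R.- a , e

  polyRawRing : RawRing c ℓ
  polyRawRing = record
    { Carrier = Poly
    ; _≈_     = _≈ₚ_
    ; _+_     = _++_
    ; _*_     = cartesianProductWith mulTerm
    ; -_      = map negTerm
    ; 0#      = []
    ; 1#      = const R.1#
    }

module _ {c ℓ} (R : RawRing c ℓ) where

  open RawRing R

  data Ideal {s} (S : Pred Carrier s) : Pred Carrier (c ⊔ ℓ ⊔ s) where
    generator : ∀ {x} → S x → Ideal S x
    zeroᴵ     : Ideal S 0#
    sumᴵ      : ∀ {x y} → Ideal S x → Ideal S y → Ideal S (x + y)
    multipleᴵ : ∀ r {x} → Ideal S x → Ideal S (r * x)
    respᴵ     : ∀ {x y} → x ≈ y → Ideal S x → Ideal S y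

-- In a Heyting field, x # y says that x - y is invertible; it is the
-- positive form of x ≉ y and coincides with it classically.

module _ {c ℓ₁ ℓ₂} (K : HeytingField c ℓ₁ ℓ₂) where

  open HeytingField K

  fieldRing : CommutativeRing c ℓ₁
  fieldRing = HeytingCommutativeRing.commutativeRing heytingCommutativeRing

  open RawSemiringDefinitions (Semiring.rawSemiring (CommutativeRing.semiring fieldRing))
    using (sum; _^_) renaming (_×_ to _·_)

  AlgebraicallyClosed : Set (c ⊔ ℓ₁ ⊔ ℓ₂)
  AlgebraicallyClosed =
    ∀ d (a : Vector Carrier (suc d)) → 0 < d → a (fromℕ d) # 0# →
    ∃ λ x → sum (λ i → a i * x ^ toℕ i) ≈ 0#

  IsCharacteristic : ℕ → Set ℓ₁
  IsCharacteristic p = ∀ m → (m · 1# ≈ 0#) ⇔ (p ∣ m)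

  record IsPrimitiveRoot (k : ℕ) (ω : Carrier) : Set (ℓ₁ ⊔ ℓ₂) where
    field
      ω^k≈1 : ω ^ k ≈ 1#
      ω^m#1 : ∀ m → 0 < m → m < k → ω ^ m # 1#

module RootOfUnity {c ℓ₁ ℓ₂} (K : HeytingField c ℓ₁ ℓ₂) {k : ℕ} (2<k : 2 < k)
  {ω : HeytingField.Carrier K} (ω-prim : IsPrimitiveRoot K k ω) where

  open HeytingField K
  open CommutativeRing (fieldRing K) using (semiring; ring)
  open RawSemiringDefinitions (Semiring.rawSemiring semiring) using (_^_)
  open IsPrimitiveRoot ω-prim
  open SetoidReasoning setoid

  private
    inverse : ∀ {m} → 0 < m → ω ^ m ≈ 1# → Invertible _≈_ 1# _*_ ω
    inverse {suc m} _ ω^m≈1 = ω ^ m , trans (*-comm _ _) ω^m≈1 , ω^m≈1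

  ω-invertible : Invertible _≈_ 1# _*_ ω
  ω-invertible = inverse (<-trans (s≤s z≤n) 2<k) ω^k≈1

  ω⁻¹ : Carrier
  ω⁻¹ = proj₁ ω-invertible

  ω^_ : ℤ → Carrier
  ω^ (+ m)    = ω ^ m
  ω^ -[1+ m ] = ω⁻¹ ^ suc m

  ω³#ω : ω ^ 3 # ω
  ω³#ω = HeytingProperties.invertibleˡ⇒# heytingCommutativeRing (u * ω⁻¹ , (begin
    u * ω⁻¹ * (ω ^ 3 - ω)          ≈⟨ *-congˡ (+-congˡ (-‿cong (*-identityʳ ω))) ⟨
    u * ω⁻¹ * (ω ^ 3 - ω * 1#)     ≈⟨ *-congˡ (RingProperties.x[y-z]≈xy-xz ring ω (ω ^ 2) 1#) ⟨
    u * ω⁻¹ * (ω * (ω ^ 2 - 1#))   ≈⟨ *-assoc u ω⁻¹ _ ⟩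
    u * (ω⁻¹ * (ω * (ω ^ 2 - 1#))) ≈⟨ *-congˡ (*-assoc ω⁻¹ ω _) ⟨
    u * (ω⁻¹ * ω * (ω ^ 2 - 1#))   ≈⟨ *-congˡ (*-congʳ (proj₁ (proj₂ ω-invertible))) ⟩
    u * (1# * (ω ^ 2 - 1#))        ≈⟨ *-congˡ (*-identityˡ _) ⟩
    u * (ω ^ 2 - 1#)               ≈⟨ proj₁ (proj₂ ω²-1-invertible) ⟩
    1#                             ∎))
    where
    ω²-1-invertible : Invertible _≈_ 1# _*_ (ω ^ 2 - 1#)
    ω²-1-invertible = #⇒invertible (ω^m#1 2 (s≤s z≤n) 2<k)

    u : Carrier
    u = proj₁ ω²-1-invertible

  infixl 7 _/[ω³-ω]
  _/[ω³-ω] : Carrier → Carrier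
  a /[ω³-ω] = a * proj₁ (#⇒invertible ω³#ω)

record SimpleDigraph (n : ℕ) : Set₁ where
  field
    Arc     : Rel (Fin n) 0ℓ
    arc?    : Decidable Arc
    no-loop : ∀ i → ¬ Arc i i

  δ⁺ : Fin n → List (Fin n)
  δ⁺ i = filter (arc? i) (allFin n)

-- Arcs may be traversed in either direction.

Connected : ∀ {n} → SimpleDigraph n → Set
Connected {n} G = ∀ (i j : Fin n) → EqClosure (SimpleDigraph.Arc G) i j

-- A cycle is presented by a cyclic listing v₁ , … , v_k of its
-- vertices, with indices read modulo k, so that v₀ = v_k.  Presentations
-- differing by the choice of v₁ describe the same set of arcs.

record Cycle {n} (G : SimpleDigraph n) (k : ℕ) : Set where
  open SimpleDigraph G
  field
    2<k      : 2 < k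
    vertices : Fin k → Fin n
    distinct : Injective _≡_ _≡_ vertices

  v : ℕ → Fin n
  v i = vertices (_mod_ i k {{>-nonZero (<-trans (s≤s z≤n) 2<k)}})

  field
    arcs : ∀ i → Arc (v i) (v (suc i))

  DoublyCovered : Set
  DoublyCovered = ∀ i → Arc (v i) (v (suc i)) × Arc (v (suc i)) (v i)

  Directed : Set
  Directed = ¬ DoublyCovered

HamiltonianCycle : ∀ {n} → SimpleDigraph n → Set
HamiltonianCycle {n} G = Cycle G n

module _ {c ℓ₁ ℓ₂} (K : HeytingField c ℓ₁ ℓ₂) {n : ℕ} (G : SimpleDigraph n) where

  open HeytingField K using (Carrier) renaming (_-_ to _-ᴷ_)
  open SimpleDigraph G
  open Polynomials (fieldRing K) n
  open RawRing polyRawRing using (rawSemiring; _+_; _*_; -_; 1#)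
  open RawSemiringDefinitions rawSemiring using (_^_)

  private
    infixl 6 _-_
    _-_ : Poly → Poly → Poly
    p - q = p + (- q)

  data HamiltonianGenerator (ω : Carrier) : Pred Poly c where
    power   : ∀ i → HamiltonianGenerator ω (X i ^ n - 1#)
    product : ∀ i → HamiltonianGenerator ω
                (foldr _*_ 1# (map (λ j → const ω * X i - X j) (δ⁺ i)))

  hamiltonianIdeal : Carrier → Pred Poly (c ⊔ ℓ₁)
  hamiltonianIdeal ω = Ideal polyRawRing (HamiltonianGenerator ω)

  module _ {ω : Carrier} (ω-prim : IsPrimitiveRoot K n ω) (C : HamiltonianCycle G) where

    open Cycle C
    open RootOfUnity K 2<k ω-prim

    data CycleGenerator : Pred Poly c where

      doubly-linear : DoublyCovered → ∀ i → 1 ≤ i → i ≤ n ∸ 2 → CycleGenerator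
        ( X (v i)
        + const ((ω^ (+ 2 +ᶻ + i) -ᴷ ω^ (+ 2 -ᶻ + i)) /[ω³-ω]) * X (v (n ∸ 1))
        + const ((ω^ (+ 1 -ᶻ + i) -ᴷ ω^ (+ 3 +ᶻ + i)) /[ω³-ω]) * X (v n) )

      doubly-quadratic : DoublyCovered → CycleGenerator
        ( (X (v (n ∸ 1)) - const ω * X (v n))
        * (X (v (n ∸ 1)) - const ω⁻¹ * X (v n)) )

      directed-linear : Directed → ∀ i → 1 ≤ i → i ≤ n ∸ 1 → CycleGenerator
        ( X (v (n ∸ i)) - const (ω^ (+ (n ∸ i))) * X (v n) )

      power : CycleGenerator (X (v n) ^ n - 1#)

    cycleIdeal : Pred Poly (c ⊔ ℓ₁)
    cycleIdeal = Ideal polyRawRing CycleGenerator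

{-# OPTIONS --safe #-}

-- Modulo x_i^n - 1 = ∏_a (x_i - ω^a), whose factors are pairwise comaximal, a
-- polynomial lies in an ideal as soon as it lies in all the ideals obtained by
-- adjoining x_i = ω^(p i) for a labelling p of the vertices.  Under such a
-- substitution either a product generator of H_G becomes a unit, or every vertex
-- has an out-neighbour with the next label; then p⁻¹ lists a Hamiltonian cycle C
-- and all generators of H_{G,C} vanish.  Conversely, modulo H_{G,C} one has
-- x_{v_i} = ω^i x_{v_n} if C is directed; if C is doubly covered the quadratic
-- generator has comaximal factors, modulo which x_{v_i} = ω^i x_{v_n} and
-- x_{v_i} = ω^{-i} x_{v_n} respectively.  In each case the generators of H_G vanish.
-- An ideal is handled through the quotient ring, i.e. the polynomials with
-- congruence modulo the ideal as their equality.

module Submission where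

open import Defs
open import Algebra.Apartness.Bundles using (HeytingField)
open import Algebra.Bundles using (AbelianGroup; CommutativeRing; RawRing)
import Algebra.Definitions.RawMagma as RawMagmaDefinitions
import Algebra.Definitions.RawSemiring as RawSemiringDefinitions
open import Algebra.Morphism.Structures using (IsRingHomomorphism)
import Algebra.Properties.AbelianGroup as AbelianGroupProperties
import Algebra.Properties.CommutativeSemigroup as CommutativeSemigroupProperties
import Algebra.Properties.CommutativeSemiring.Exp as CommutativeExponentiation
import Algebra.Properties.Ring as RingProperties
import Algebra.Properties.Semiring.Exp as Exponentiation
import Algebra.Properties.Semiring.Mult as Multiplication
import Algebra.Solver.Ring
open import Algebra.Solver.Ring.AlmostCommutativeRing using (fromCommutativeRing; _-Raw-AlmostCommutative⟶_)
open import Data.Bool.Base using (true; false)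
open import Data.Fin.Base using (Fin; toℕ; fromℕ<; punchOut)
open import Data.Fin.Properties
  using (toℕ<n; toℕ-fromℕ<; toℕ-injective; any?; all?; injective⇒≤; punchOut-injective; ¬∀⟶∃¬)
  renaming (_≟_ to _≟ᶠ_)
open import Data.Integer.Base using (+_; _⊖_) renaming (_+_ to _+ᶻ_; _-_ to _-ᶻ_)
import Data.Integer.Properties as ℤ
open import Data.List.Base using (List; []; _∷_; _++_; map; foldr; length; allFin; applyUpTo; cartesianProductWith)
  renaming (replicate to replicateᴸ)
open import Data.List.Membership.Propositional using (_∈_)
open import Data.List.Membership.Propositional.Properties using (∈-filter⁺; ∈-filter⁻; ∈-allFin; ∈-map⁺)
open import Data.List.Properties using (map-++; cartesianProductWith-distribʳ-++; length-applyUpTo; length-replicate)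
open import Data.List.Relation.Unary.All as All using (All; []; _∷_)
import Data.List.Relation.Unary.All.Properties as All
open import Data.List.Relation.Unary.AllPairs using (AllPairs; []; _∷_)
import Data.List.Relation.Unary.AllPairs.Properties as AllPairs
open import Data.List.Relation.Unary.Any using (here; there)
open import Data.Maybe.Base using (Maybe; just; nothing)
open import Data.Nat.Base as ℕ using (ℕ; zero; suc; NonZero; _∸_; _≥_)
open import Data.Nat.Divisibility using (_∣_)
open import Data.Nat.DivMod
  using (_%_; _/_; _mod_; m≡m%n+[m/n]*n; m%n<n; m<n⇒m%n≡m; n%n≡0; [m+n]%n≡m%n; m%n%n≡m%n; %-distribˡ-+)
import Data.Nat.Properties as ℕ
open import Data.Product.Base using (_×_; _,_; proj₁; proj₂; ∃; ∃₂)
open import Data.Sum.Base using (inj₁; inj₂)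
open import Data.Vec.Base using (replicate)
open import Data.Vec.Properties using (≡-dec; zipWith-assoc; zipWith-comm; zipWith-identityˡ)
open import Function.Base using (id)
open import Function.Definitions using (Injective)
open import Level using (_⊔_)
open import Relation.Binary.Core using (Rel)
open import Relation.Binary.Definitions using (tri<; tri≈; tri>)
open import Relation.Binary.PropositionalEquality.Core as ≡ using (_≡_; _≢_)
import Relation.Binary.Reasoning.Setoid as SetoidReasoning
open import Relation.Nullary.Decidable using (Dec; does; yes; no; _×-dec_; map′)
open import Relation.Nullary.Negation.Core using (¬_; contradiction)
open import Relation.Unary using (Pred; _∪_; ｛_｝; _⊆_; _≐_; ⋂)

-- Ring identities by reflection.

-- The standard ring solver with formal differences of natural numbers as
-- coefficients, so that it sees cancellation in an arbitrary commutative ring.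

module RingSolver {c ℓ} (R : CommutativeRing c ℓ) where

  open CommutativeRing R
  open RingProperties ring
  open Multiplication semiring using (×-homo-+; ×1-homo-*) renaming (_×_ to _·_)
  open CommutativeSemigroupProperties
    (AbelianGroup.commutativeSemigroup +-abelianGroup) using (interchange)
  open SetoidReasoning setoid

  private
    formalDifferences : RawRing _ _
    formalDifferences = record
      { Carrier = ℕ × ℕ
      ; _≈_     = _≡_
      ; _+_     = λ (a , b) (c , d) → a ℕ.+ c , b ℕ.+ d
      ; _*_     = λ (a , b) (c , d) → a ℕ.* c ℕ.+ b ℕ.* d , a ℕ.* d ℕ.+ b ℕ.* c
      ; -_      = λ (a , b) → b , a
      ; 0#      = 0 , 0
      ; 1#      = 1 , 0
      }

    value : ℕ × ℕ → Carrier
    value (a , b) = a · 1# - b · 1#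

    [x+y]-[z+w] : ∀ x y z w → (x + y) - (z + w) ≈ (x - z) + (y - w)
    [x+y]-[z+w] x y z w = begin
      (x + y) - (z + w)       ≈⟨ +-congˡ (-‿+-comm z w) ⟨
      (x + y) + (- z + - w)   ≈⟨ interchange x y (- z) (- w) ⟩
      (x - z) + (y - w)       ∎

    -x*-y : ∀ x y → - x * - y ≈ x * y
    -x*-y x y = begin
      - x * - y      ≈⟨ -‿distribˡ-* x (- y) ⟨
      - (x * - y)    ≈⟨ -‿cong (-‿distribʳ-* x y) ⟨
      - - (x * y)    ≈⟨ -‿involutive (x * y) ⟩
      x * y          ∎

    [x-y][z-w] : ∀ x y z w → (x - y) * (z - w) ≈ (x * z + y * w) - (x * w + y * z)
    [x-y][z-w] x y z w = begin
      (x - y) * (z - w)                              ≈⟨ distribʳ (z - w) x (- y) ⟩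
      x * (z - w) + - y * (z - w)                    ≈⟨ +-cong (distribˡ x z (- w)) (distribˡ (- y) z (- w)) ⟩
      (x * z + x * - w) + (- y * z + - y * - w)      ≈⟨ +-congˡ (+-comm _ _) ⟩
      (x * z + x * - w) + (- y * - w + - y * z)      ≈⟨ interchange _ _ _ _ ⟩
      (x * z + - y * - w) + (x * - w + - y * z)
        ≈⟨ +-cong (+-congˡ (-x*-y y w))
            (+-cong (sym (-‿distribʳ-* x w)) (sym (-‿distribˡ-* y z))) ⟩
      (x * z + y * w) + (- (x * w) + - (y * z))      ≈⟨ +-congˡ (-‿+-comm _ _) ⟩
      (x * z + y * w) - (x * w + y * z)              ∎

    +-homo : ∀ p q → value (RawRing._+_ formalDifferences p q) ≈ value p + value q
    +-homo (a , b) (c , d) = begin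
      (a ℕ.+ c) · 1# - (b ℕ.+ d) · 1#             ≈⟨ +-cong (×-homo-+ 1# a c) (-‿cong (×-homo-+ 1# b d)) ⟩
      (a · 1# + c · 1#) - (b · 1# + d · 1#)       ≈⟨ [x+y]-[z+w] _ _ _ _ ⟩
      value (a , b) + value (c , d)               ∎

    sum-of-products : ∀ a b c d → (a ℕ.* b ℕ.+ c ℕ.* d) · 1# ≈ a · 1# * b · 1# + c · 1# * d · 1#
    sum-of-products a b c d = trans (×-homo-+ 1# (a ℕ.* b) (c ℕ.* d)) (+-cong (×1-homo-* a b) (×1-homo-* c d))

    *-homo : ∀ p q → value (RawRing._*_ formalDifferences p q) ≈ value p * value q
    *-homo (a , b) (c , d) = begin
      (a ℕ.* c ℕ.+ b ℕ.* d) · 1# - (a ℕ.* d ℕ.+ b ℕ.* c) · 1#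
        ≈⟨ +-cong (sum-of-products a c b d) (-‿cong (sum-of-products a d b c)) ⟩
      (a · 1# * c · 1# + b · 1# * d · 1#) - (a · 1# * d · 1# + b · 1# * c · 1#)
        ≈⟨ [x-y][z-w] _ _ _ _ ⟨
      value (a , b) * value (c , d) ∎

    -‿homo : ∀ p → value (RawRing.-_ formalDifferences p) ≈ - value p
    -‿homo (a , b) = sym (⁻¹-anti-homo‿- (a · 1#) (b · 1#))

    morphism : formalDifferences -Raw-AlmostCommutative⟶ fromCommutativeRing R
    morphism = record
      { ⟦_⟧    = value
      ; +-homo = +-homo
      ; *-homo = *-homo
      ; -‿homo = -‿homo
      ; 0-homo = -‿inverseʳ 0#
      ; 1-homo = trans (+-cong (+-identityʳ 1#) -0#≈0#) (+-identityʳ 1#)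
      }

    -- Pairs are never normalised, so different pairs can denote the same integer. Adding the pairs
    -- `(d , d)` and `(b , b)`, whose value is zero, makes the two sides literally the same pair.
    value-cong : ∀ a b c d → a ℕ.+ d ≡ c ℕ.+ b → value (a , b) ≈ value (c , d)
    value-cong a b c d eq = begin
      value (a , b)                       ≈⟨ +-identityʳ _ ⟨
      value (a , b) + 0#                  ≈⟨ +-congˡ (-‿inverseʳ (d · 1#)) ⟨
      value (a , b) + value (d , d)       ≈⟨ +-homo (a , b) (d , d) ⟨
      value (a ℕ.+ d , b ℕ.+ d)           ≡⟨ ≡.cong₂ (λ m k → value (m , k)) eq (ℕ.+-comm b d) ⟩
      value (c ℕ.+ b , d ℕ.+ b)           ≈⟨ +-homo (c , d) (b , b) ⟩
      value (c , d) + value (b , b)       ≈⟨ +-congˡ (-‿inverseʳ (b · 1#)) ⟩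
      value (c , d) + 0#                  ≈⟨ +-identityʳ _ ⟩
      value (c , d)                       ∎

    _value≟_ : ∀ p q → Maybe (value p ≈ value q)
    (a , b) value≟ (c , d) with a ℕ.+ d ℕ.≟ c ℕ.+ b
    ... | yes eq = just (value-cong a b c d eq)
    ... | no _   = nothing

  open Algebra.Solver.Ring formalDifferences (fromCommutativeRing R) morphism _value≟_ public
    using (solve; _:=_; _:+_; _:*_; _:-_; :-_)

-- The polynomial ring and its quotients by ideals.

module PolynomialQuotient {c ℓ} (R : CommutativeRing c ℓ) (n : ℕ) where

  open Polynomials R n

  private
    module R = CommutativeRing R
    open RingProperties R.ring using (-0#≈0#; -‿+-comm; -1*x≈-x)

    infixl 7 _*_
    _*_ : Poly → Poly → Poly
    _*_ = cartesianProductWith mulTerm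

    neg : Poly → Poly
    neg = map negTerm

  coeff-++ : ∀ p q m → coeff (p ++ q) m R.≈ coeff p m R.+ coeff q m
  coeff-++ []            q m = R.sym (R.+-identityˡ _)
  coeff-++ ((a , e) ∷ p) q m = R.trans (R.+-congˡ (coeff-++ p q m)) (R.sym (R.+-assoc _ _ _))

  coeff-neg : ∀ p m → coeff (neg p) m R.≈ R.- coeff p m
  coeff-neg []            m = R.sym -0#≈0#
  coeff-neg ((a , e) ∷ p) m with does (≡-dec ℕ._≟_ e m)
  ... | true  = R.trans (R.+-congˡ (coeff-neg p m)) (-‿+-comm _ _)
  ... | false = R.trans (R.+-cong (R.sym -0#≈0#) (coeff-neg p m)) (-‿+-comm _ _)

  +-abelianGroup : AbelianGroup c ℓ
  +-abelianGroup = record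
    { _≈_ = _≈ₚ_
    ; _∙_ = _++_
    ; ε   = []
    ; _⁻¹ = neg
    ; isAbelianGroup = record
      { isGroup = record
        { isMonoid = record
          { isSemigroup = record
            { isMagma = record
              { isEquivalence = record
                { refl  = mk≈ₚ λ m → R.refl
                ; sym   = λ (mk≈ₚ p≈q) → mk≈ₚ λ m → R.sym (p≈q m)
                ; trans = λ (mk≈ₚ p≈q) (mk≈ₚ q≈r) → mk≈ₚ λ m → R.trans (p≈q m) (q≈r m)
                }
              ; ∙-cong = λ {p} {q} {r} {s} (mk≈ₚ p≈q) (mk≈ₚ r≈s) → mk≈ₚ λ m →
                  R.trans (coeff-++ p r m) (R.trans (R.+-cong (p≈q m) (r≈s m)) (R.sym (coeff-++ q s m)))
              }
            ; assoc = λ p q r → mk≈ₚ λ m → R.trans (coeff-++ (p ++ q) r m)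
                (R.trans (R.+-congʳ (coeff-++ p q m))
                (R.trans (R.+-assoc _ _ _)
                (R.trans (R.+-congˡ (R.sym (coeff-++ q r m))) (R.sym (coeff-++ p (q ++ r) m)))))
            }
          ; identity = (λ p → mk≈ₚ λ m → R.refl) ,
                       (λ p → mk≈ₚ λ m → R.trans (coeff-++ p [] m) (R.+-identityʳ _))
          }
        ; inverse = (λ p → mk≈ₚ λ m → R.trans (coeff-++ (neg p) p m)
                      (R.trans (R.+-congʳ (coeff-neg p m)) (R.-‿inverseˡ _))) ,
                    (λ p → mk≈ₚ λ m → R.trans (coeff-++ p (neg p) m)
                      (R.trans (R.+-congˡ (coeff-neg p m)) (R.-‿inverseʳ _)))
        ; ⁻¹-cong = λ {p} {q} (mk≈ₚ p≈q) → mk≈ₚ λ m →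
            R.trans (coeff-neg p m) (R.trans (R.-‿cong (p≈q m)) (R.sym (coeff-neg q m)))
        }
      ; comm = λ p q → mk≈ₚ λ m → R.trans (coeff-++ p q m)
          (R.trans (R.+-comm _ _) (R.sym (coeff-++ q p m)))
      }
    }

  open AbelianGroup +-abelianGroup
    using (refl; sym; trans; reflexive; setoid; ∙-cong; ∙-congˡ; ∙-congʳ)
    renaming (assoc to ++-assoc; identityʳ to ++-identityʳ; comm to ++-comm; inverseʳ to ++-inverseʳ)
  open AbelianGroupProperties +-abelianGroup
    using (⁻¹-∙-comm; ⁻¹-anti-homo‿-)
  open CommutativeSemigroupProperties (AbelianGroup.commutativeSemigroup +-abelianGroup)
    using (interchange)
  open SetoidReasoning setoid

  infix 4 _≈ₜ_
  _≈ₜ_ : Term → Term → Set ℓ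
  (a , e) ≈ₜ (b , f) = a R.≈ b × e ≡ f

  -- With this, the laws of multiplication are proved term by term on lists, and no coefficient of a
  -- product is ever computed.
  ∷-cong : ∀ {s t p q} → s ≈ₜ t → p ≈ₚ q → s ∷ p ≈ₚ t ∷ q
  ∷-cong {a , e} {b , .e} {p} {q} (a≈b , ≡.refl) (mk≈ₚ p≈q) = mk≈ₚ step
    where
    step : ∀ m → coeff ((a , e) ∷ p) m R.≈ coeff ((b , e) ∷ q) m
    step m with does (≡-dec ℕ._≟_ e m)
    ... | true  = R.+-cong a≈b (p≈q m)
    ... | false = R.+-congˡ (p≈q m)

  map-cong-≈ₚ : ∀ {f g : Term → Term} → (∀ t → f t ≈ₜ g t) → ∀ p → map f p ≈ₚ map g p
  map-cong-≈ₚ f≈g []      = refl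
  map-cong-≈ₚ f≈g (t ∷ p) = ∷-cong (f≈g t) (map-cong-≈ₚ f≈g p)

  map-∘-≈ₚ : ∀ {f g h : Term → Term} → (∀ t → f t ≈ₜ g (h t)) → ∀ p → map f p ≈ₚ map g (map h p)
  map-∘-≈ₚ f≈gh []      = refl
  map-∘-≈ₚ f≈gh (t ∷ p) = ∷-cong (f≈gh t) (map-∘-≈ₚ f≈gh p)

  mulTerm-comm : ∀ s t → mulTerm s t ≈ₜ mulTerm t s
  mulTerm-comm (a , e) (b , f) = R.*-comm a b , zipWith-comm ℕ.+-comm e f

  mulTerm-assoc : ∀ s t u → mulTerm (mulTerm s t) u ≈ₜ mulTerm s (mulTerm t u)
  mulTerm-assoc (a , e) (b , f) (d , g) = R.*-assoc a b d , zipWith-assoc ℕ.+-assoc e f g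

  mulTerm-negˡ : ∀ s t → mulTerm (negTerm s) t ≈ₜ negTerm (mulTerm s t)
  mulTerm-negˡ (a , e) (b , f) = R.sym (RingProperties.-‿distribˡ-* R.ring a b) , ≡.refl

  *-distribˡ-++ : ∀ p q r → p * (q ++ r) ≈ₚ p * q ++ p * r
  *-distribˡ-++ []      q r = refl
  *-distribˡ-++ (t ∷ p) q r = begin
    map (mulTerm t) (q ++ r) ++ p * (q ++ r)
      ≈⟨ ∙-cong (reflexive (map-++ (mulTerm t) q r)) (*-distribˡ-++ p q r) ⟩
    (map (mulTerm t) q ++ map (mulTerm t) r) ++ (p * q ++ p * r)
      ≈⟨ interchange (map (mulTerm t) q) _ _ _ ⟩
    (map (mulTerm t) q ++ p * q) ++ (map (mulTerm t) r ++ p * r) ∎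

  *-distribʳ-++ : ∀ r p q → (p ++ q) * r ≈ₚ p * r ++ q * r
  *-distribʳ-++ r p q = reflexive (cartesianProductWith-distribʳ-++ mulTerm p q r)

  *-[t] : ∀ p t → p * (t ∷ []) ≈ₚ map (mulTerm t) p
  *-[t] []      t = refl
  *-[t] (s ∷ p) t = ∷-cong (mulTerm-comm s t) (*-[t] p t)

  *-zeroʳ : ∀ p → p * [] ≈ₚ []
  *-zeroʳ []      = refl
  *-zeroʳ (t ∷ p) = *-zeroʳ p

  *-comm : ∀ p q → p * q ≈ₚ q * p
  *-comm []      q = sym (*-zeroʳ q)
  *-comm (t ∷ p) q = begin
    map (mulTerm t) q ++ p * q   ≈⟨ ∙-cong (sym (*-[t] q t)) (*-comm p q) ⟩
    q * (t ∷ []) ++ q * p        ≈⟨ *-distribˡ-++ q (t ∷ []) p ⟨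
    q * (t ∷ p)                  ∎

  map-mulTerm-* : ∀ t p q → map (mulTerm t) p * q ≈ₚ map (mulTerm t) (p * q)
  map-mulTerm-* t []      q = refl
  map-mulTerm-* t (s ∷ p) q = begin
    map (mulTerm (mulTerm t s)) q ++ map (mulTerm t) p * q
      ≈⟨ ∙-cong (map-∘-≈ₚ (mulTerm-assoc t s) q) (map-mulTerm-* t p q) ⟩
    map (mulTerm t) (map (mulTerm s) q) ++ map (mulTerm t) (p * q)
      ≡⟨ map-++ (mulTerm t) (map (mulTerm s) q) (p * q) ⟨
    map (mulTerm t) (map (mulTerm s) q ++ p * q) ∎

  *-assoc : ∀ p q r → (p * q) * r ≈ₚ p * (q * r)
  *-assoc []      q r = refl
  *-assoc (t ∷ p) q r = begin
    (map (mulTerm t) q ++ p * q) * r       ≈⟨ *-distribʳ-++ r (map (mulTerm t) q) (p * q) ⟩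
    map (mulTerm t) q * r ++ (p * q) * r   ≈⟨ ∙-cong (map-mulTerm-* t q r) (*-assoc p q r) ⟩
    map (mulTerm t) (q * r) ++ p * (q * r) ∎

  *-negˡ : ∀ p q → neg p * q ≈ₚ neg (p * q)
  *-negˡ []      q = refl
  *-negˡ (t ∷ p) q = begin
    map (mulTerm (negTerm t)) q ++ neg p * q         ≈⟨ ∙-cong (map-∘-≈ₚ (mulTerm-negˡ t) q) (*-negˡ p q) ⟩
    neg (map (mulTerm t) q) ++ neg (p * q)           ≡⟨ map-++ negTerm (map (mulTerm t) q) (p * q) ⟨
    neg (map (mulTerm t) q ++ p * q)                 ∎

  *-negʳ : ∀ p q → p * neg q ≈ₚ neg (p * q)
  *-negʳ p q = begin
    p * neg q     ≈⟨ *-comm p (neg q) ⟩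
    neg q * p     ≈⟨ *-negˡ q p ⟩
    neg (q * p)   ≈⟨ AbelianGroup.⁻¹-cong +-abelianGroup (*-comm q p) ⟩
    neg (p * q)   ∎

  const-* : ∀ a p → const a * p ≈ₚ map (λ (b , e) → a R.* b , e) p
  const-* a p = trans (++-identityʳ _)
    (map-cong-≈ₚ (λ (b , e) → R.refl , zipWith-identityˡ ℕ.+-identityˡ e) p)

  *-identityˡ : ∀ p → const R.1# * p ≈ₚ p
  *-identityˡ []            = refl
  *-identityˡ ((b , e) ∷ p) = ∷-cong (R.*-identityˡ b , zipWith-identityˡ ℕ.+-identityˡ e) (*-identityˡ p)

  const-cong : ∀ {a b} → a R.≈ b → const a ≈ₚ const b
  const-cong a≈b = ∷-cong (a≈b , ≡.refl) refl

  const-+ : ∀ a b → const (a R.+ b) ≈ₚ const a ++ const b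
  const-+ a b = mk≈ₚ step
    where
    step : ∀ m → coeff (const (a R.+ b)) m R.≈ coeff (const a ++ const b) m
    step m with does (≡-dec ℕ._≟_ (replicate n 0) m)
    ... | true  = R.+-assoc a b R.0#
    ... | false = R.sym (R.+-identityˡ _)

  const-*-const : ∀ a b → const (a R.* b) ≈ₚ const a * const b
  const-*-const a b = ∷-cong (R.refl , ≡.sym (zipWith-identityˡ ℕ.+-identityˡ (replicate n 0))) refl

  const-0 : const R.0# ≈ₚ []
  const-0 = mk≈ₚ step
    where
    step : ∀ m → coeff (const R.0#) m R.≈ R.0#
    step m with does (≡-dec ℕ._≟_ (replicate n 0) m)
    ... | true  = R.+-identityˡ _
    ... | false = R.+-identityˡ _

  -- Ideals are closed under multiples but have no clause for negation; this turns `neg p` into a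
  -- multiple of `p`.
  neg-≈ : ∀ p → const (R.- R.1#) * p ≈ₚ neg p
  neg-≈ p = trans (const-* (R.- R.1#) p) (map-cong-≈ₚ (λ (b , e) → -1*x≈-x b , ≡.refl) p)

  module _ {s} (S : Pred Poly s) where

    infix 4 _∼_
    -- A record, so that `p` and `q` can be inferred from the type; unification cannot recover them
    -- from `p ++ neg q`.
    record _∼_ (p q : Poly) : Set (c ⊔ ℓ ⊔ s) where
      constructor mk∼
      field
        difference∈ : Ideal polyRawRing S (p ++ neg q)

    private
      negᴵ : ∀ {p} → Ideal polyRawRing S p → Ideal polyRawRing S (neg p)
      negᴵ {p} p∈ = respᴵ (neg-≈ p) (multipleᴵ (const (R.- R.1#)) p∈)

    ≈ₚ⇒∼ : ∀ {p q} → p ≈ₚ q → p ∼ q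
    ≈ₚ⇒∼ {p} {q} p≈q = mk∼ (respᴵ (sym (trans (∙-congʳ p≈q) (++-inverseʳ q))) zeroᴵ)

    ∼-sym : ∀ {p q} → p ∼ q → q ∼ p
    ∼-sym {p} {q} (mk∼ p-q∈) = mk∼ (respᴵ (⁻¹-anti-homo‿- p q) (negᴵ p-q∈))

    private
      [p-q]+[q-r] : ∀ p q r → (p ++ neg q) ++ (q ++ neg r) ≈ₚ p ++ neg r
      [p-q]+[q-r] p q r = begin
        (p ++ neg q) ++ (q ++ neg r)   ≈⟨ ++-assoc p _ _ ⟩
        p ++ (neg q ++ (q ++ neg r))   ≈⟨ ∙-congˡ {p} (sym (++-assoc (neg q) q _)) ⟩
        p ++ ((neg q ++ q) ++ neg r)   ≈⟨ ∙-congˡ {p} (∙-congʳ (AbelianGroup.inverseˡ +-abelianGroup q)) ⟩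
        p ++ neg r                     ∎

      [p-q]+[r-s] : ∀ p q r s → (p ++ neg q) ++ (r ++ neg s) ≈ₚ (p ++ r) ++ neg (q ++ s)
      [p-q]+[r-s] p q r s = begin
        (p ++ neg q) ++ (r ++ neg s)   ≈⟨ interchange p _ _ _ ⟩
        (p ++ r) ++ (neg q ++ neg s)   ≈⟨ ∙-congˡ {p ++ r} (⁻¹-∙-comm q s) ⟩
        (p ++ r) ++ neg (q ++ s)       ∎

      p[q-r] : ∀ p q r → p * (q ++ neg r) ≈ₚ p * q ++ neg (p * r)
      p[q-r] p q r = trans (*-distribˡ-++ p q (neg r)) (∙-congˡ {p * q} (*-negʳ p r))

    ∼-trans : ∀ {p q r} → p ∼ q → q ∼ r → p ∼ r
    ∼-trans {p} {q} {r} (mk∼ p-q∈) (mk∼ q-r∈) =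
      mk∼ (respᴵ ([p-q]+[q-r] p q r) (sumᴵ p-q∈ q-r∈))

    ++-cong-∼ : ∀ {p q r s} → p ∼ q → r ∼ s → p ++ r ∼ q ++ s
    ++-cong-∼ {p} {q} {r} {s} (mk∼ p-q∈) (mk∼ r-s∈) =
      mk∼ (respᴵ ([p-q]+[r-s] p q r s) (sumᴵ p-q∈ r-s∈))

    neg-cong-∼ : ∀ {p q} → p ∼ q → neg p ∼ neg q
    neg-cong-∼ {p} {q} (mk∼ p-q∈) = mk∼ (respᴵ (sym (⁻¹-∙-comm p (neg q))) (negᴵ p-q∈))

    -- An ideal absorbs multiplication of the difference by `r`. Through `≈ₚ⇒∼` this also covers
    -- factors that agree coefficientwise.
    *-congˡ-∼ : ∀ r {p q} → p ∼ q → r * p ∼ r * q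
    *-congˡ-∼ r {p} {q} (mk∼ p-q∈) = mk∼ (respᴵ (p[q-r] r p q) (multipleᴵ r p-q∈))

    *-cong-∼ : ∀ {p q r s} → p ∼ q → r ∼ s → p * r ∼ q * s
    *-cong-∼ {p} {q} {r} {s} p∼q r∼s =
      ∼-trans (*-congˡ-∼ p r∼s)
      (∼-trans (≈ₚ⇒∼ (*-comm p s))
      (∼-trans (*-congˡ-∼ s p∼q) (≈ₚ⇒∼ (*-comm s q))))

    -- Carrier and operations are the same for every `S`, so one polynomial can be read in several
    -- quotients without a projection map.
    quotient : CommutativeRing c (c ⊔ ℓ ⊔ s)
    quotient = record
      { _≈_ = _∼_
      ; _+_ = _++_
      ; _*_ = _*_
      ; -_  = neg
      ; 0#  = []
      ; 1#  = const R.1#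
      ; isCommutativeRing = record
        { isRing = record
          { +-isAbelianGroup = record
            { isGroup = record
              { isMonoid = record
                { isSemigroup = record
                  { isMagma = record
                    { isEquivalence = record { refl = ≈ₚ⇒∼ refl ; sym = ∼-sym ; trans = ∼-trans }
                    ; ∙-cong = ++-cong-∼
                    }
                  ; assoc = λ p q r → ≈ₚ⇒∼ (++-assoc p q r)
                  }
                ; identity = (λ p → ≈ₚ⇒∼ refl) , (λ p → ≈ₚ⇒∼ (++-identityʳ p))
                }
              ; inverse = (λ p → ≈ₚ⇒∼ (AbelianGroup.inverseˡ +-abelianGroup p)) ,
                          (λ p → ≈ₚ⇒∼ (++-inverseʳ p))
              ; ⁻¹-cong = neg-cong-∼
              }
            ; comm = λ p q → ≈ₚ⇒∼ (++-comm p q)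
            }
          ; *-cong = *-cong-∼
          ; *-assoc = λ p q r → ≈ₚ⇒∼ (*-assoc p q r)
          ; *-identity = (λ p → ≈ₚ⇒∼ (*-identityˡ p)) ,
                         (λ p → ≈ₚ⇒∼ (trans (*-comm p _) (*-identityˡ p)))
          ; distrib = (λ p q r → ≈ₚ⇒∼ (*-distribˡ-++ p q r)) ,
                      (λ p q r → ≈ₚ⇒∼ (*-distribʳ-++ p q r))
          }
        ; *-comm = λ p q → ≈ₚ⇒∼ (*-comm p q)
        }
      }

    const-isRingHomomorphism :
      IsRingHomomorphism R.rawRing (CommutativeRing.rawRing quotient) const
    const-isRingHomomorphism = record
      { isSemiringHomomorphism = record
        { isNearSemiringHomomorphism = record
          { +-isMonoidHomomorphism = record
            { isMagmaHomomorphism = record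
              { isRelHomomorphism = record { cong = λ a≈b → ≈ₚ⇒∼ (const-cong a≈b) }
              ; homo = λ a b → ≈ₚ⇒∼ (const-+ a b)
              }
            ; ε-homo = ≈ₚ⇒∼ const-0
            }
          ; *-homo = λ a b → ≈ₚ⇒∼ (const-*-const a b)
          }
        ; 1#-homo = ≈ₚ⇒∼ refl
        }
      ; -‿homo = λ a → ≈ₚ⇒∼ refl
      }

    ∈⇒∼0 : ∀ {p} → Ideal polyRawRing S p → p ∼ []
    ∈⇒∼0 p∈ = mk∼ (respᴵ (sym (++-identityʳ _)) p∈)

    ∼0⇒∈ : ∀ {p} → p ∼ [] → Ideal polyRawRing S p
    ∼0⇒∈ (mk∼ p∈) = respᴵ (++-identityʳ _) p∈

-- Units, comaximal elements and divisibility in a commutative ring.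

module Factorization {c ℓ} (R : CommutativeRing c ℓ) where

  open CommutativeRing R
  open RingSolver R
  open RingProperties ring using (-0#≈0#; x≈y⇒x∙y⁻¹≈ε)
  open RawMagmaDefinitions *-rawMagma using (_∣ʳ_; _,_) public
  open Exponentiation semiring
  open SetoidReasoning setoid

  Unit : Pred Carrier (c ⊔ ℓ)
  Unit a = ∃ λ b → b * a ≈ 1#

  unit-cong : ∀ {a b} → a ≈ b → Unit a → Unit b
  unit-cong a≈b (e , ea≈1) = e , trans (*-congˡ (sym a≈b)) ea≈1

  unit-* : ∀ {a b} → Unit a → Unit b → Unit (a * b)
  unit-* {a} {b} (d , da≈1) (e , eb≈1) = d * e , (begin
    d * e * (a * b)     ≈⟨ solve 4 (λ d e a b → d :* e :* (a :* b) := d :* a :* (e :* b)) refl d e a b ⟩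
    d * a * (e * b)     ≈⟨ *-cong da≈1 eb≈1 ⟩
    1# * 1#             ≈⟨ *-identityˡ 1# ⟩
    1#                  ∎)

  unit-neg : ∀ {a} → Unit a → Unit (- a)
  unit-neg {a} (e , ea≈1) = - e , trans (solve 2 (λ e a → :- e :* (:- a) := e :* a) refl e a) ea≈1

  unit-^ : ∀ {a} → Unit a → ∀ m → Unit (a ^ m)
  unit-^ u zero    = 1# , *-identityˡ 1#
  unit-^ u (suc m) = unit-* u (unit-^ u m)

  unit-cancel : ∀ {a x} → Unit a → a * x ≈ 0# → x ≈ 0#
  unit-cancel {a} {x} (e , ea≈1) ax≈0 = begin
    x             ≈⟨ *-identityˡ x ⟨
    1# * x        ≈⟨ *-congʳ ea≈1 ⟨
    e * a * x     ≈⟨ *-assoc e a x ⟩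
    e * (a * x)   ≈⟨ *-congˡ ax≈0 ⟩
    e * 0#        ≈⟨ zeroʳ e ⟩
    0#            ∎

  Comaximal : Rel Carrier (c ⊔ ℓ)
  Comaximal a b = ∃₂ λ d e → d * a + e * b ≈ 1#

  unit-difference⇒comaximal : ∀ {a b} → Unit (a - b) → Comaximal a b
  unit-difference⇒comaximal {a} {b} (e , eq) = e , - e , trans
    (solve 3 (λ e a b → e :* a :+ :- e :* b := e :* (a :- b)) refl e a b) eq

  -- Multiply the Bézout identities of the head and of the tail: every term contains a factor `a`,
  -- except the one with `b * d`.
  comaximal-product : ∀ {a bs} → All (Comaximal a) bs → Comaximal a (foldr _*_ 1# bs)
  comaximal-product {a} [] = 0# , 1# , trans (+-cong (zeroˡ a) (*-identityˡ 1#)) (+-identityˡ 1#)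
  comaximal-product {a} {b ∷ bs} ((p , q , eq) ∷ cs) with comaximal-product cs
  ... | r , s , eq′ = p * (r * a + s * d) + q * b * r , q * s , (begin
    (p * (r * a + s * d) + q * b * r) * a + q * s * (b * d)
      ≈⟨ solve 7 (λ p q r s a b d →
           (p :* (r :* a :+ s :* d) :+ q :* b :* r) :* a :+ q :* s :* (b :* d)
             := (p :* a :+ q :* b) :* (r :* a :+ s :* d)) refl p q r s a b d ⟩
    (p * a + q * b) * (r * a + s * d)   ≈⟨ *-cong eq eq′ ⟩
    1# * 1#                             ≈⟨ *-identityˡ 1# ⟩
    1#                                  ∎)
    where d = foldr _*_ 1# bs

  -- In f = p a f + q b f, replace f by v b in the first summand and by u a in the second; both
  -- become multiples of a b.
  comaximal-∣ : ∀ {a b f} → Comaximal a b → a ∣ʳ f → b ∣ʳ f → a * b ∣ʳ f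
  comaximal-∣ {a} {b} {f} (p , q , pa+qb≈1) (u , ua≈f) (v , vb≈f) = p * v + q * u , (begin
    (p * v + q * u) * (a * b)
      ≈⟨ solve 6 (λ p q u v a b → (p :* v :+ q :* u) :* (a :* b)
         := p :* a :* (v :* b) :+ q :* b :* (u :* a)) refl p q u v a b ⟩
    p * a * (v * b) + q * b * (u * a) ≈⟨ +-cong (*-congˡ vb≈f) (*-congˡ ua≈f) ⟩
    p * a * f + q * b * f             ≈⟨ distribʳ f _ _ ⟨
    (p * a + q * b) * f               ≈⟨ *-congʳ pa+qb≈1 ⟩
    1# * f                            ≈⟨ *-identityˡ f ⟩
    f                                 ∎)

  product-∣ : ∀ {as f} → AllPairs Comaximal as → All (_∣ʳ f) as → foldr _*_ 1# as ∣ʳ f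
  product-∣ {f = f} []       []           = f , *-identityʳ f
  product-∣         (c ∷ cs) (a∣f ∷ as∣f) = comaximal-∣ (comaximal-product c) a∣f (product-∣ cs as∣f)

  0∣⇒≈0 : ∀ {a f} → a ≈ 0# → a ∣ʳ f → f ≈ 0#
  0∣⇒≈0 a≈0 (q , qa≈f) = trans (sym qa≈f) (trans (*-congˡ a≈0) (zeroʳ q))

  -- Splitting x^n - 1 into linear factors.

  -- The value at x of the monic polynomial with the given lower coefficients,
  -- constant term first.
  horner : List Carrier → Carrier → Carrier
  horner []       x = 1#
  horner (c ∷ cs) x = c + x * horner cs x

  -- Dividing the polynomial with lower coefficients `c ∷ cs` by x - a gives a quotient with lower
  -- coefficients `syntheticQuotient a cs`: Horner's scheme, whose entries are the values at `a` of
  -- the successive tails. The constant term `c` enters only the remainder.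
  syntheticQuotient : Carrier → List Carrier → List Carrier
  syntheticQuotient a []       = []
  syntheticQuotient a (c ∷ cs) = horner (c ∷ cs) a ∷ syntheticQuotient a cs

  length-syntheticQuotient : ∀ a cs → length (syntheticQuotient a cs) ≡ length cs
  length-syntheticQuotient a []       = ≡.refl
  length-syntheticQuotient a (c ∷ cs) = ≡.cong suc (length-syntheticQuotient a cs)

  horner-difference : ∀ a c cs x →
    horner (c ∷ cs) x - horner (c ∷ cs) a ≈ (x - a) * horner (syntheticQuotient a cs) x
  horner-difference a c []       x =
    solve 4 (λ a c x e → (c :+ x :* e) :- (c :+ a :* e) := (x :- a) :* e) refl a c x 1#
  horner-difference a c (d ∷ cs) x = begin
    (c + x * hx) - (c + a * ha)
      ≈⟨ solve 5 (λ a c x hx ha → (c :+ x :* hx) :- (c :+ a :* ha)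
         := x :* (hx :- ha) :+ (x :- a) :* ha) refl a c x hx ha ⟩
    x * (hx - ha) + (x - a) * ha
      ≈⟨ +-congʳ (*-congˡ (horner-difference a d cs x)) ⟩
    x * ((x - a) * q) + (x - a) * ha
      ≈⟨ solve 4 (λ a x q ha → x :* ((x :- a) :* q) :+ (x :- a) :* ha
         := (x :- a) :* (ha :+ x :* q)) refl a x q ha ⟩
    (x - a) * (ha + x * q) ∎
    where
    hx = horner (d ∷ cs) x
    ha = horner (d ∷ cs) a
    q  = horner (syntheticQuotient a cs) x

  horner-factor : ∀ a c cs → horner (c ∷ cs) a ≈ 0# → ∀ x →
    horner (c ∷ cs) x ≈ (x - a) * horner (syntheticQuotient a cs) x
  horner-factor a c cs root x = begin
    horner (c ∷ cs) x                          ≈⟨ +-identityʳ _ ⟨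
    horner (c ∷ cs) x + 0#                     ≈⟨ +-congˡ -0#≈0# ⟨
    horner (c ∷ cs) x - 0#                     ≈⟨ +-congˡ (-‿cong root) ⟨
    horner (c ∷ cs) x - horner (c ∷ cs) a      ≈⟨ horner-difference a c cs x ⟩
    (x - a) * horner (syntheticQuotient a cs) x ∎

  -- Split off the first root `a`. Any other root `b` makes (b - a) times the quotient vanish at
  -- `b`; since b - a is a unit, `b` is a root of the quotient even in a ring with zero divisors.
  -- With equal lengths, the leading coefficient 1 remains at the end.
  horner-product : ∀ as cs → length as ≡ length cs →
    AllPairs (λ a b → Unit (a - b)) as → All (λ a → horner cs a ≈ 0#) as →
    ∀ x → horner cs x ≈ foldr _*_ 1# (map (λ a → x - a) as)
  horner-product []       []       _  []       []             x = refl
  horner-product (a ∷ as) (c ∷ cs) eq (u ∷ us) (root ∷ roots) x =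
    trans (horner-factor a c cs root x) (*-congˡ (horner-product as (syntheticQuotient a cs)
      (≡.trans (ℕ.suc-injective eq) (≡.sym (length-syntheticQuotient a cs)))
      us (All.map quotient-root (All.zip (u , roots))) x))
    where
    quotient-root : ∀ {b} → Unit (a - b) × horner (c ∷ cs) b ≈ 0# →
                    horner (syntheticQuotient a cs) b ≈ 0#
    quotient-root {b} (unit , root′) = unit-cancel
      (unit-cong (solve 2 (λ a b → :- (a :- b) := b :- a) refl a b) (unit-neg unit))
      (trans (sym (horner-factor a c cs root b)) root′)

  horner-zeros : ∀ m x → horner (replicateᴸ m 0#) x ≈ x ^ m
  horner-zeros zero    x = refl
  horner-zeros (suc m) x = trans (+-identityˡ _) (*-congˡ (horner-zeros m x))

  1^ : ∀ m → 1# ^ m ≈ 1#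
  1^ zero    = refl
  1^ (suc m) = trans (*-identityˡ _) (1^ m)

  root-power : ∀ n {ζ} → ζ ^ n ≈ 1# → ∀ i → (ζ ^ i) ^ n ≈ 1#
  root-power n {ζ} ζ^n≈1 i = begin
    (ζ ^ i) ^ n      ≈⟨ ^-assocʳ ζ i n ⟩
    ζ ^ (i ℕ.* n)    ≡⟨ ≡.cong (ζ ^_) (ℕ.*-comm i n) ⟩
    ζ ^ (n ℕ.* i)    ≈⟨ ^-assocʳ ζ n i ⟨
    (ζ ^ n) ^ i      ≈⟨ ^-congˡ i ζ^n≈1 ⟩
    1# ^ i           ≈⟨ 1^ i ⟩
    1#               ∎

  module _ {n ζ} (n>0 : 0 ℕ.< n) (ζ^n≈1 : ζ ^ n ≈ 1#)
           (distinct : ∀ {i j} → i ℕ.< j → j ℕ.< n → Unit (ζ ^ i - ζ ^ j)) where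

    -- The powers of `ζ` are n roots, with unit differences, of the monic polynomial whose lower
    -- coefficients are -1 followed by n - 1 zeros.
    x^n-1≈product : ∀ x → x ^ n - 1# ≈ foldr _*_ 1# (map (λ a → x - a) (applyUpTo (ζ ^_) n))
    x^n-1≈product x = trans (sym (value n>0 x)) (horner-product (applyUpTo (ζ ^_) n) (coefficients n)
      (≡.trans (length-applyUpTo (ζ ^_) n) (≡.sym (length-coefficients n>0)))
      (AllPairs.applyUpTo⁺₁ (ζ ^_) n distinct)
      (All.applyUpTo⁺₂ (ζ ^_) n λ i → trans (value n>0 (ζ ^ i)) (x≈y⇒x∙y⁻¹≈ε (root-power n ζ^n≈1 i)))
      x)
      where
      coefficients : ℕ → List Carrier
      coefficients m = - 1# ∷ replicateᴸ (ℕ.pred m) 0#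

      length-coefficients : ∀ {m} → 0 ℕ.< m → length (coefficients m) ≡ m
      length-coefficients {suc m} _ = ≡.cong suc (length-replicate m)

      value : ∀ {m} → 0 ℕ.< m → ∀ x → horner (coefficients m) x ≈ x ^ m - 1#
      value {suc m} _ x = trans (+-comm _ _) (+-congʳ (*-congˡ (horner-zeros m x)))

    -- The factors x - ζ^i differ by units, hence are pairwise comaximal, so their product divides
    -- `f`. That product is x^n - 1, which is zero.
    root-split : ∀ {x f} → x ^ n ≈ 1# → (∀ {i} → i ℕ.< n → x - ζ ^ i ∣ʳ f) → f ≈ 0#
    root-split {x} {f} x^n≈1 factor∣f = 0∣⇒≈0
      (trans (sym (x^n-1≈product x)) (x≈y⇒x∙y⁻¹≈ε x^n≈1))
      (product-∣
        (AllPairs.map⁺ (AllPairs.applyUpTo⁺₁ (ζ ^_) n λ i<j j<n →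
          unit-difference⇒comaximal (unit-cong
            (solve 3 (λ x a b → :- (a :- b) := (x :- a) :- (x :- b)) refl x _ _)
            (unit-neg (distinct i<j j<n)))))
        (All.map⁺ (All.applyUpTo⁺₁ (ζ ^_) n factor∣f)))

-- Powers of a primitive root of unity and the coefficients of the linear generators.

module PrimitiveRoot {c ℓ₁ ℓ₂} (K : HeytingField c ℓ₁ ℓ₂) {n : ℕ} (2<n : 2 ℕ.< n)
  {ω : HeytingField.Carrier K} (ω-prim : IsPrimitiveRoot K n ω) where

  open CommutativeRing (fieldRing K)
  open RingSolver (fieldRing K)
  open Factorization (fieldRing K)
  open Exponentiation semiring
  open CommutativeExponentiation commutativeSemiring using (^-distrib-*)
  open IsPrimitiveRoot ω-prim
  open RootOfUnity K 2<n ω-prim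
  open SetoidReasoning setoid

  private instance
    n-nonZero : NonZero n
    n-nonZero = ℕ.>-nonZero (ℕ.<-trans (ℕ.s≤s ℕ.z≤n) 2<n)

  ω*ω⁻¹≈1 : ω * ω⁻¹ ≈ 1#
  ω*ω⁻¹≈1 = proj₂ (proj₂ ω-invertible)

  ω⁻¹^n≈1 : ω⁻¹ ^ n ≈ 1#
  ω⁻¹^n≈1 = begin
    ω⁻¹ ^ n           ≈⟨ *-identityˡ _ ⟨
    1# * ω⁻¹ ^ n      ≈⟨ *-congʳ ω^k≈1 ⟨
    ω ^ n * ω⁻¹ ^ n   ≈⟨ ^-distrib-* ω ω⁻¹ n ⟨
    (ω * ω⁻¹) ^ n     ≈⟨ ^-congˡ n ω*ω⁻¹≈1 ⟩
    1# ^ n            ≈⟨ 1^ n ⟩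
    1#                ∎

  -- Matches the exponent n - 1 belonging to v_{n-1} with the ratios ω and ω⁻¹ in the quadratic
  -- generator.
  inverse≈^[n-1] : ∀ {ζ ζ⁻¹} → ζ * ζ⁻¹ ≈ 1# → ζ ^ n ≈ 1# → ζ ^ (n ℕ.∸ 1) ≈ ζ⁻¹
  inverse≈^[n-1] {ζ} {ζ⁻¹} ζζ⁻¹≈1 ζ^n≈1 = begin
    ζ ^ (n ℕ.∸ 1)              ≈⟨ *-identityʳ _ ⟨
    ζ ^ (n ℕ.∸ 1) * 1#         ≈⟨ *-congˡ ζζ⁻¹≈1 ⟨
    ζ ^ (n ℕ.∸ 1) * (ζ * ζ⁻¹)  ≈⟨ solve 3 (λ a b d → a :* (b :* d) := b :* a :* d) refl (ζ ^ (n ℕ.∸ 1)) ζ ζ⁻¹ ⟩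
    ζ ^ suc (n ℕ.∸ 1) * ζ⁻¹    ≡⟨ ≡.cong (λ m → ζ ^ m * ζ⁻¹) (ℕ.suc-pred n) ⟩
    ζ ^ n * ζ⁻¹                ≈⟨ *-congʳ ζ^n≈1 ⟩
    1# * ζ⁻¹                   ≈⟨ *-identityˡ _ ⟩
    ζ⁻¹                        ∎

  ^-% : ∀ {ζ} → ζ ^ n ≈ 1# → ∀ m → ζ ^ (m % n) ≈ ζ ^ m
  ^-% {ζ} ζ^n≈1 m = sym (begin
    ζ ^ m                                ≡⟨ ≡.cong (ζ ^_) (m≡m%n+[m/n]*n m n) ⟩
    ζ ^ (m % n ℕ.+ m / n ℕ.* n)          ≈⟨ ^-homo-* ζ (m % n) _ ⟩
    ζ ^ (m % n) * ζ ^ (m / n ℕ.* n)      ≡⟨ ≡.cong (λ k → ζ ^ (m % n) * ζ ^ k) (ℕ.*-comm (m / n) n) ⟩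
    ζ ^ (m % n) * ζ ^ (n ℕ.* (m / n))    ≈⟨ *-congˡ (^-assocʳ ζ n (m / n)) ⟨
    ζ ^ (m % n) * (ζ ^ n) ^ (m / n)      ≈⟨ *-congˡ (trans (^-congˡ (m / n) ζ^n≈1) (1^ (m / n))) ⟩
    ζ ^ (m % n) * 1#                     ≈⟨ *-identityʳ _ ⟩
    ζ ^ (m % n)                          ∎)

  -- The difference is -ω^i (ω^(j-i) - 1), and the last factor is invertible by primitivity because
  -- 0 < j - i < n.
  power-difference-unit : ∀ {i j} → i ℕ.< j → j ℕ.< n → Unit (ω ^ i - ω ^ j)
  power-difference-unit {i} {j} i<j j<n = unit-cong difference
    (unit-neg (unit-* (unit-^ ω-unit i) difference-unit))
    where
    ω-unit : Unit ω
    ω-unit = ω⁻¹ , proj₁ (proj₂ ω-invertible)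

    difference-unit : Unit (ω ^ (j ℕ.∸ i) - 1#)
    difference-unit with u , eq , _ ← HeytingField.#⇒invertible K
      (ω^m#1 (j ℕ.∸ i) (ℕ.m<n⇒0<n∸m i<j) (ℕ.≤-<-trans (ℕ.m∸n≤m j i) j<n)) = u , eq

    difference : - (ω ^ i * (ω ^ (j ℕ.∸ i) - 1#)) ≈ ω ^ i - ω ^ j
    difference = begin
      - (ω ^ i * (ω ^ (j ℕ.∸ i) - 1#))
        ≈⟨ solve 3 (λ a b e → :- (a :* (b :- e)) := a :* e :- a :* b) refl (ω ^ i) _ 1# ⟩
      ω ^ i * 1# - ω ^ i * ω ^ (j ℕ.∸ i)      ≈⟨ +-cong (*-identityʳ _) (-‿cong (sym (^-homo-* ω i _))) ⟩
      ω ^ i - ω ^ (i ℕ.+ (j ℕ.∸ i))           ≡⟨ ≡.cong (λ m → ω ^ i - ω ^ m) (ℕ.m+[n∸m]≡n (ℕ.<⇒≤ i<j)) ⟩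
      ω ^ i - ω ^ j                           ∎

  incongruent-difference-unit : ∀ i j → i % n ≢ j % n → Unit (ω ^ i - ω ^ j)
  incongruent-difference-unit i j i≢j = unit-cong (+-cong (^-% ω^k≈1 i) (-‿cong (^-% ω^k≈1 j))) unit
    where
    unit : Unit (ω ^ (i % n) - ω ^ (j % n))
    unit with ℕ.<-cmp (i % n) (j % n)
    ... | tri< i<j _ _ = power-difference-unit i<j (m%n<n j n)
    ... | tri≈ _ i≡j _ = contradiction i≡j i≢j
    ... | tri> _ _ j<i = unit-cong (solve 2 (λ a b → :- (b :- a) := a :- b) refl (ω ^ (i % n)) (ω ^ (j % n)))
                           (unit-neg (power-difference-unit j<i (m%n<n i n)))

  -- The exponents 2 - i and 1 - i of the generators become negative for larger i; splitting off
  -- ω⁻¹^k removes the case distinction on the sign.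
  ω^⊖ : ∀ m k → (ω^ (m ⊖ k)) ≈ ω ^ m * ω⁻¹ ^ k
  ω^⊖ m       zero    = sym (*-identityʳ _)
  ω^⊖ zero    (suc k) = sym (*-identityˡ _)
  ω^⊖ (suc m) (suc k) = begin
    (ω^ (suc m ⊖ suc k))            ≡⟨ ≡.cong ω^_ (ℤ.[1+m]⊖[1+n]≡m⊖n m k) ⟩
    (ω^ (m ⊖ k))                    ≈⟨ ω^⊖ m k ⟩
    ω ^ m * ω⁻¹ ^ k                 ≈⟨ *-identityˡ _ ⟨
    1# * (ω ^ m * ω⁻¹ ^ k)          ≈⟨ *-congʳ ω*ω⁻¹≈1 ⟨
    ω * ω⁻¹ * (ω ^ m * ω⁻¹ ^ k)
      ≈⟨ solve 4 (λ a b d e → a :* b :* (d :* e) := a :* d :* (b :* e)) refl ω ω⁻¹ (ω ^ m) (ω⁻¹ ^ k) ⟩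
    ω ^ suc m * ω⁻¹ ^ suc k         ∎

  ω^- : ∀ m k → (ω^ (+ m -ᶻ + k)) ≈ ω ^ m * ω⁻¹ ^ k
  ω^- m k = trans (reflexive (≡.cong ω^_ (ℤ.m-n≡m⊖n m k))) (ω^⊖ m k)

  -- The coefficients of y = x_{v_{n-1}} and z = x_{v_n} in the i-th linear generator of a doubly
  -- covered cycle.
  coefficientʸ coefficientᶻ : ℕ → Carrier
  coefficientʸ i = ((ω^ (+ 2 +ᶻ + i)) - (ω^ (+ 2 -ᶻ + i))) /[ω³-ω]
  coefficientᶻ i = ((ω^ (+ 1 -ᶻ + i)) - (ω^ (+ 3 +ᶻ + i))) /[ω³-ω]

  private
    e : Carrier
    e = proj₁ (HeytingField.#⇒invertible K ω³#ω)

    p q : ℕ → Carrier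
    p i = ω ^ i
    q i = ω⁻¹ ^ i

    coefficientʸ≈ : ∀ i → coefficientʸ i ≈ (ω * (ω * p i) - ω * ω * q i) * e
    coefficientʸ≈ i = *-congʳ (+-congˡ (-‿cong (trans (ω^- 2 i) (*-congʳ (*-congˡ (*-identityʳ ω))))))

    coefficientᶻ≈ : ∀ i → coefficientᶻ i ≈ (ω * q i - ω * (ω * (ω * p i))) * e
    coefficientᶻ≈ i = *-congʳ (+-congʳ (trans (ω^- 1 i) (*-congʳ (*-identityʳ ω))))

    e-inverse : e * (ω * (ω * ω) - ω) ≈ 1#
    e-inverse = trans (*-congˡ (+-congʳ (*-congˡ (*-congˡ (sym (*-identityʳ ω))))))
      (proj₁ (proj₂ (HeytingField.#⇒invertible K ω³#ω)))

  -- The two values of x_{v_{n-1}} / x_{v_n} allowed by the quadratic generator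
  -- turn the linear ones into x_{v_i} = ω^{±i} x_{v_n}.
  coefficients-at-ω⁻¹ : ∀ i → coefficientʸ i * ω⁻¹ + coefficientᶻ i ≈ - ω ^ i
  coefficients-at-ω⁻¹ i = begin
    coefficientʸ i * ω⁻¹ + coefficientᶻ i
      ≈⟨ +-cong (*-congʳ (coefficientʸ≈ i)) (coefficientᶻ≈ i) ⟩
    (ω * (ω * p i) - ω * ω * q i) * e * ω⁻¹ + (ω * q i - ω * (ω * (ω * p i))) * e
      -- The solver knows no relation between its variables, so the right side isolates w v and e
      -- (w³ - w), which the next step replaces by 1.
      ≈⟨ solve 5 (λ w v p q e → (w :* (w :* p) :- w :* w :* q) :* e :* v :+ (w :* q :- w :* (w :* (w :* p))) :* e
           := (w :* v) :* (w :* p :- w :* q) :* e :- (w :* p :- w :* q) :* e :- e :* (w :* (w :* w) :- w) :* p)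
           refl ω ω⁻¹ (p i) (q i) e ⟩
    ω * ω⁻¹ * r * e - r * e - e * (ω * (ω * ω) - ω) * p i
      ≈⟨ +-cong (+-congʳ (*-congʳ (trans (*-congʳ ω*ω⁻¹≈1) (*-identityˡ _)))) (-‿cong (trans (*-congʳ e-inverse) (*-identityˡ _))) ⟩
    r * e - r * e - p i
      ≈⟨ solve 2 (λ a p → a :- a :- p := :- p) refl (r * e) (p i) ⟩
    - ω ^ i ∎
    where r = ω * p i - ω * q i

  coefficients-at-ω : ∀ i → coefficientʸ i * ω + coefficientᶻ i ≈ - ω⁻¹ ^ i
  coefficients-at-ω i = begin
    coefficientʸ i * ω + coefficientᶻ i
      ≈⟨ +-cong (*-congʳ (coefficientʸ≈ i)) (coefficientᶻ≈ i) ⟩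
    (ω * (ω * p i) - ω * ω * q i) * e * ω + (ω * q i - ω * (ω * (ω * p i))) * e
      ≈⟨ solve 4 (λ w p q e → (w :* (w :* p) :- w :* w :* q) :* e :* w :+ (w :* q :- w :* (w :* (w :* p))) :* e
           := :- (e :* (w :* (w :* w) :- w) :* q)) refl ω (p i) (q i) e ⟩
    - (e * (ω * (ω * ω) - ω) * q i)
      ≈⟨ -‿cong (trans (*-congʳ e-inverse) (*-identityˡ _)) ⟩
    - ω⁻¹ ^ i ∎

  -- Multiplying by ω² gives ω³ - ω, whose inverse is `e`.
  ω-ω⁻¹-unit : Unit (ω - ω⁻¹)
  ω-ω⁻¹-unit = e * (ω * ω) , (begin
    e * (ω * ω) * (ω - ω⁻¹)
      ≈⟨ solve 3 (λ e w v → e :* (w :* w) :* (w :- v)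
         := e :* (w :* (w :* w) :- w :* (w :* v))) refl e ω ω⁻¹ ⟩
    e * (ω * (ω * ω) - ω * (ω * ω⁻¹))
      ≈⟨ *-congˡ (+-congˡ (-‿cong (trans (*-congˡ ω*ω⁻¹≈1) (*-identityʳ ω)))) ⟩
    e * (ω * (ω * ω) - ω)                   ≈⟨ e-inverse ⟩
    1#                                      ∎)

-- Finite sets and the cyclic indexing of a Hamiltonian cycle.

-- Pigeonhole principle: removing a missed value from the codomain would leave an injection from n +
-- 1 elements into n.
injective⇒surjective : ∀ {n} {f : Fin n → Fin n} → Injective _≡_ _≡_ f → ∀ y → ∃ λ x → f x ≡ y
injective⇒surjective {suc n} {f} f-injective y with any? (λ x → f x ≟ᶠ y)
... | yes surjective = surjective
... | no  missed     = contradiction (injective⇒≤ avoid-injective) ℕ.1+n≰n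
  where
  y≢f : ∀ x → y ≢ f x
  y≢f x eq = missed (x , ≡.sym eq)

  avoid : Fin (suc n) → Fin n
  avoid x = punchOut (y≢f x)

  avoid-injective : Injective _≡_ _≡_ avoid
  avoid-injective {i} {j} eq = f-injective (punchOut-injective (y≢f i) (y≢f j) eq)

toℕ-mod : ∀ i n .{{_ : NonZero n}} → toℕ (i mod n) ≡ i % n
toℕ-mod i n = toℕ-fromℕ< (m%n<n i n)

module CycleProperties {n} {G : SimpleDigraph n} (C : HamiltonianCycle G) where

  open Cycle C
  open SimpleDigraph G

  private instance
    n-nonZero : NonZero n
    n-nonZero = ℕ.>-nonZero (ℕ.<-trans (ℕ.s≤s ℕ.z≤n) 2<k)

  v-cong-% : ∀ {i j} → i % n ≡ j % n → v i ≡ v j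
  v-cong-% {i} {j} eq = ≡.cong vertices (toℕ-injective
    (≡.trans (toℕ-mod i n) (≡.trans eq (≡.sym (toℕ-mod j n)))))

  vertices≡v : ∀ r → vertices r ≡ v (toℕ r)
  vertices≡v r = ≡.cong vertices (toℕ-injective (≡.sym
    (≡.trans (toℕ-mod (toℕ r) n) (m<n⇒m%n≡m (toℕ<n r)))))

  v0≡vn : v 0 ≡ v n
  v0≡vn = v-cong-% (≡.trans (m<n⇒m%n≡m (ℕ.<-trans (ℕ.s≤s ℕ.z≤n) 2<k)) (≡.sym (n%n≡0 n)))

  v-surjective : ∀ w → ∃ λ i → i ℕ.< n × v i ≡ w
  v-surjective w with r , eq ← injective⇒surjective distinct w =
    toℕ r , toℕ<n r , ≡.trans (≡.sym (vertices≡v r)) eq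

  -- Modulo n, adding n - 1 is a step back; unlike truncated subtraction it is also right at index
  -- 0.
  predecessor : ℕ → ℕ
  predecessor i = i ℕ.+ ℕ.pred n

  v-suc-predecessor : ∀ i → v (suc (predecessor i)) ≡ v i
  v-suc-predecessor i = v-cong-% (≡.trans
    (≡.cong (_% n) (≡.trans (≡.sym (ℕ.+-suc i (ℕ.pred n))) (≡.cong (i ℕ.+_) (ℕ.suc-pred n))))
    ([m+n]%n≡m%n i n))

  -- The condition speaks of all natural indices but is periodic modulo n, so a check of the n
  -- residues decides it.
  doublyCovered? : Dec DoublyCovered
  doublyCovered? = map′ (λ covered i → cover i (covered (i mod n))) (λ covered r → covered (toℕ r))
    (all? λ r → arc? (v (toℕ r)) (v (suc (toℕ r))) ×-dec arc? (v (suc (toℕ r))) (v (toℕ r)))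
    where
    cover : ∀ i → let j = toℕ (i mod n) in
            Arc (v j) (v (suc j)) × Arc (v (suc j)) (v j) →
            Arc (v i) (v (suc i)) × Arc (v (suc i)) (v i)
    cover i = ≡.subst₂ (λ a b → Arc a b × Arc b a) (v-cong-% j%n≡i%n) (v-cong-% 1+j%n≡1+i%n)
      where
      j = toℕ (i mod n)

      j%n≡i%n : j % n ≡ i % n
      j%n≡i%n = ≡.trans (≡.cong (_% n) (toℕ-mod i n)) (m%n%n≡m%n i n)

      1+j%n≡1+i%n : suc j % n ≡ suc i % n
      1+j%n≡1+i%n = ≡.trans (%-distribˡ-+ 1 j n)
        (≡.trans (≡.cong (λ m → (1 % n ℕ.+ m) % n) j%n≡i%n) (≡.sym (%-distribˡ-+ 1 i n)))

-- Vanishing of the generators in a quotient of the polynomial ring.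

module _ {c ℓ₁ ℓ₂} (K : HeytingField c ℓ₁ ℓ₂) {n : ℕ} where

  private
    module F where
      open CommutativeRing (fieldRing K) public
      open Exponentiation semiring public
      open Factorization (fieldRing K) using (Unit; root-power) public

  open Polynomials (fieldRing K) n
  open PolynomialQuotient (fieldRing K) n
    using (quotient; const-isRingHomomorphism; ≈ₚ⇒∼; ∈⇒∼0; ∼0⇒∈)

  module QuotientProperties (S : Pred Poly c) where

    open CommutativeRing (quotient S)
    open IsRingHomomorphism (const-isRingHomomorphism S)
      using (+-homo; *-homo; ⟦⟧-cong)
    open Exponentiation semiring
    open CommutativeExponentiation commutativeSemiring using (^-distrib-*)
    open Factorization (quotient S)
    open RingProperties ring using (x≈y⇒x∙y⁻¹≈ε; x∙y⁻¹≈ε⇒x≈y)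
    open RingSolver (quotient S)
    open SetoidReasoning setoid
    private module P = RawSemiringDefinitions (RawRing.rawSemiring polyRawRing)

    -- The generators are written with the power of the raw polynomial structure, while the exponent
    -- laws concern the power of the quotient ring.
    ^-agrees : ∀ p m → p P.^ m ≡ p ^ m
    ^-agrees p zero    = ≡.refl
    ^-agrees p (suc m) = ≡.cong (p *_) (^-agrees p m)

    power-generator⇒ : ∀ {p m} → p P.^ m - 1# ≈ 0# → p ^ m ≈ 1#
    power-generator⇒ {p} {m} eq = x∙y⁻¹≈ε⇒x≈y (p ^ m) 1# (trans (+-congʳ { - 1#} (reflexive (≡.sym (^-agrees p m)))) eq)

    power-generator⇐ : ∀ {p m} → p ^ m ≈ 1# → p P.^ m - 1# ≈ 0#
    power-generator⇐ {p} {m} eq = x≈y⇒x∙y⁻¹≈ε (trans (reflexive (^-agrees p m)) eq)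

    const-^ : ∀ a m → const (a F.^ m) ≈ const a ^ m
    const-^ a zero    = refl
    const-^ a (suc m) = trans (*-homo a (a F.^ m)) (*-congˡ {const a} (const-^ a m))

    const-unit : ∀ {a} → F.Unit a → Unit (const a)
    const-unit {a} (b , ba≈1) = const b , trans (sym (*-homo b a)) (⟦⟧-cong ba≈1)

    const-difference : ∀ a b → const (a F.- b) ≈ const a - const b
    const-difference a b = +-homo a (F.- b)

    -- What vanishes modulo `S` is closed under all ideal operations, so inclusions of ideals can be
    -- checked on generators.
    generated-⊆ : ∀ {t} {T : Pred Poly t} → (∀ {p} → T p → p ≈ 0#) →
                  ∀ {p} → Ideal polyRawRing T p → p ≈ 0#
    generated-⊆ T≈0 (generator p∈T)     = T≈0 p∈T
    generated-⊆ T≈0 zeroᴵ               = refl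
    generated-⊆ T≈0 (sumᴵ p∈ q∈)        = trans (+-cong (generated-⊆ T≈0 p∈) (generated-⊆ T≈0 q∈)) (+-identityˡ 0#)
    generated-⊆ T≈0 (multipleᴵ r p∈)    = trans (*-congˡ {r} (generated-⊆ T≈0 p∈)) (zeroʳ r)
    generated-⊆ T≈0 (respᴵ p≈q p∈)      = trans (sym (≈ₚ⇒∼ S p≈q)) (generated-⊆ T≈0 p∈)

    -- Modulo `S`, only multiples of `u` remain of the enlarged ideal. This converts membership
    -- after adjoining `u` into the divisibility that `root-split` and `comaximal-∣` take as input.
    ∈⇒∣ : ∀ {u p} → Ideal polyRawRing (S ∪ ｛ u ｝) p → u ∣ʳ p
    ∈⇒∣ {u} (generator (inj₁ p∈S)) = 0# , sym (∈⇒∼0 S (generator p∈S))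
    ∈⇒∣ {u} (generator (inj₂ ≡.refl)) = 1# , *-identityˡ u
    ∈⇒∣ zeroᴵ = 0# , refl
    ∈⇒∣ {u} (sumᴵ {x} {y} x∈ y∈) with a , au≈x ← ∈⇒∣ x∈ | b , bu≈y ← ∈⇒∣ y∈ =
      a + b , trans (distribʳ u a b) (+-cong {a * u} {x} {b * u} {y} au≈x bu≈y)
    ∈⇒∣ {u} (multipleᴵ r {x} x∈) with a , au≈x ← ∈⇒∣ x∈ =
      r * a , trans (*-assoc r a u) (*-congˡ {r} au≈x)
    ∈⇒∣ (respᴵ x≈y x∈) with a , au≈x ← ∈⇒∣ x∈ = a , trans au≈x (≈ₚ⇒∼ S x≈y)

    product-zero : ∀ {ps : List Poly} {p} → p ∈ ps → p ≈ 0# → foldr _*_ 1# ps ≈ 0#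
    product-zero {ps = q ∷ ps} (here ≡.refl) p≈0 = trans (*-congʳ {foldr _*_ 1# ps} p≈0) (zeroˡ (foldr _*_ 1# ps))
    product-zero {ps = q ∷ ps} (there p∈) p≈0 = trans (*-congˡ {q} (product-zero p∈ p≈0)) (zeroʳ q)

    product-unit : ∀ {ps : List Poly} → All Unit ps → Unit (foldr _*_ 1# ps)
    product-unit []       = 1# , *-identityˡ 1#
    product-unit (u ∷ us) = unit-* u (product-unit us)

    -- Substituting y = ζ z merges the last two terms. It is used in both directions: to read x = d
    -- z off a linear generator, and to show that the generator vanishes.
    doubly-linear-value : ∀ {a b d ζ x y z} → y ≈ const ζ * z → a F.* ζ F.+ b F.≈ F.- d →
      x + const a * y + const b * z ≈ x - const d * z
    doubly-linear-value {a} {b} {d} {ζ} {x} {y} {z} y≈ζz aζ+b≈-d = begin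
      x + const a * y + const b * z
        ≈⟨ +-congʳ {const b * z} (+-congˡ {x} (*-congˡ {const a} y≈ζz)) ⟩
      x + const a * (const ζ * z) + const b * z
        ≈⟨ solve 5 (λ x a ζ z b → x :+ a :* (ζ :* z) :+ b :* z
           := x :+ (a :* ζ :+ b) :* z) refl x (const a) (const ζ) z (const b) ⟩
      x + (const a * const ζ + const b) * z
        ≈⟨ +-congˡ {x} (*-congʳ {z} (+-congʳ {const b} (sym (*-homo a ζ)))) ⟩
      x + (const (a F.* ζ) + const b) * z
        ≈⟨ +-congˡ {x} (*-congʳ {z} (trans (sym (+-homo (a F.* ζ) b)) (⟦⟧-cong aζ+b≈-d))) ⟩
      x + - const d * z
        ≈⟨ solve 3 (λ x d z → x :+ :- d :* z := x :- d :* z) refl x (const d) z ⟩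
      x - const d * z ∎

    module _ {G : SimpleDigraph n} {ω : F.Carrier} where

      open SimpleDigraph G

      -- A single out-neighbour w′ with x_{w′} = ω x_w kills one factor of the product at w.
      hamiltonian-vanishes : (∀ w → X w ^ n ≈ 1#) →
        (∀ w → ∃ λ w′ → Arc w w′ × X w′ ≈ const ω * X w) →
        ∀ {p} → HamiltonianGenerator K G ω p → p ≈ 0#
      hamiltonian-vanishes powers successor (power i) = power-generator⇐ {X i} {n} (powers i)
      hamiltonian-vanishes powers successor (product i) with j , arc , eq ← successor i =
        product-zero (∈-map⁺ (λ j → const ω * X i - X j) (∈-filter⁺ (arc? i) (∈-allFin j) arc))
          (x≈y⇒x∙y⁻¹≈ε (sym eq))

    module _ {G : SimpleDigraph n} (C : HamiltonianCycle G) {ω : F.Carrier} (ω-prim : IsPrimitiveRoot K n ω) where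

      open Cycle C
      open CycleProperties C
      open SimpleDigraph G
      open IsPrimitiveRoot ω-prim
      open RootOfUnity K 2<k ω-prim using (ω⁻¹)
      open PrimitiveRoot K 2<k ω-prim

      private instance
        n-nonZero : NonZero n
        n-nonZero = ℕ.>-nonZero (ℕ.<-trans (ℕ.s≤s ℕ.z≤n) 2<k)

      -- Each step along `C` multiplies the coordinate by `ζ`. Below, `ζ` is `ω` when the
      -- coordinates grow along `C`, and `ω⁻¹` when they grow against it.
      Follows : F.Carrier → Set _
      Follows ζ = ∀ i → X (v i) ≈ const (ζ F.^ i) * X (v n)

      -- Both sides are periodic in `i` modulo n, and index 0 holds because v_0 is v_n and ζ^0 is 1.
      follows : ∀ {ζ} → ζ F.^ n F.≈ F.1# →
        (∀ i → 0 ℕ.< i → i ℕ.< n → X (v i) ≈ const (ζ F.^ i) * X (v n)) → Follows ζ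
      follows {ζ} ζ^n≈1 inner i = begin
        X (v i)                             ≡⟨ ≡.cong X (v-cong-% (m%n%n≡m%n i n)) ⟨
        X (v (i % n))                       ≈⟨ reduced (i % n) (m%n<n i n) ⟩
        const (ζ F.^ (i % n)) * X (v n)     ≈⟨ *-congʳ {X (v n)} (⟦⟧-cong (^-% ζ^n≈1 i)) ⟩
        const (ζ F.^ i) * X (v n)           ∎
        where
        reduced : ∀ i → i ℕ.< n → X (v i) ≈ const (ζ F.^ i) * X (v n)
        reduced zero    _   = trans (reflexive (≡.cong X v0≡vn)) (sym (*-identityˡ (X (v n))))
        reduced (suc i) i<n = inner (suc i) (ℕ.s≤s ℕ.z≤n) i<n

      follows⇒powers : ∀ {ζ} → ζ F.^ n F.≈ F.1# → X (v n) ^ n ≈ 1# → Follows ζ → ∀ w → X w ^ n ≈ 1#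
      follows⇒powers {ζ} ζ^n≈1 z^n≈1 path w with i , _ , ≡.refl ← v-surjective w = begin
        X (v i) ^ n                             ≈⟨ ^-congˡ n (path i) ⟩
        (const (ζ F.^ i) * X (v n)) ^ n         ≈⟨ ^-distrib-* (const (ζ F.^ i)) (X (v n)) n ⟩
        const (ζ F.^ i) ^ n * X (v n) ^ n       ≈⟨ *-cong (sym (const-^ (ζ F.^ i) n)) z^n≈1 ⟩
        const ((ζ F.^ i) F.^ n) * 1#            ≈⟨ *-identityʳ (const ((ζ F.^ i) F.^ n)) ⟩
        const ((ζ F.^ i) F.^ n)                 ≈⟨ ⟦⟧-cong (F.root-power n ζ^n≈1 i) ⟩
        1#                                      ∎

      forward-vanishes : X (v n) ^ n ≈ 1# → Follows ω →
        ∀ {p} → HamiltonianGenerator K G ω p → p ≈ 0#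
      forward-vanishes z^n≈1 path = hamiltonian-vanishes (follows⇒powers ω^k≈1 z^n≈1 path) successor
        where
        successor : ∀ w → ∃ λ w′ → Arc w w′ × X w′ ≈ const ω * X w
        successor w with i , _ , ≡.refl ← v-surjective w = v (suc i) , arcs i , (begin
          X (v (suc i))                             ≈⟨ path (suc i) ⟩
          const (ω F.* ω F.^ i) * X (v n)           ≈⟨ *-congʳ {X (v n)} (*-homo ω (ω F.^ i)) ⟩
          const ω * const (ω F.^ i) * X (v n)       ≈⟨ *-assoc (const ω) (const (ω F.^ i)) (X (v n)) ⟩
          const ω * (const (ω F.^ i) * X (v n))     ≈⟨ *-congˡ {const ω} (path i) ⟨
          const ω * X (v i)                         ∎)

      -- The out-neighbour with coordinate ω x_w is now the predecessor of w on `C`, reached by the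
      -- reverse arc that a doubly covered cycle provides.
      backward-vanishes : DoublyCovered → X (v n) ^ n ≈ 1# → Follows ω⁻¹ →
        ∀ {p} → HamiltonianGenerator K G ω p → p ≈ 0#
      backward-vanishes covered z^n≈1 path =
        hamiltonian-vanishes (follows⇒powers ω⁻¹^n≈1 z^n≈1 path) successor
        where
        step : ∀ i → X (v i) ≈ const ω * X (v (suc i))
        step i = begin
          X (v i)                                             ≈⟨ path i ⟩
          const (ω⁻¹ F.^ i) * X (v n)                         ≈⟨ *-congʳ {X (v n)} (⟦⟧-cong cancel) ⟩
          const (ω F.* ω⁻¹ F.^ suc i) * X (v n)               ≈⟨ *-congʳ {X (v n)} (*-homo ω (ω⁻¹ F.^ suc i)) ⟩
          const ω * const (ω⁻¹ F.^ suc i) * X (v n)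
            ≈⟨ *-assoc (const ω) (const (ω⁻¹ F.^ suc i)) (X (v n)) ⟩
          const ω * (const (ω⁻¹ F.^ suc i) * X (v n))         ≈⟨ *-congˡ {const ω} (path (suc i)) ⟨
          const ω * X (v (suc i))                             ∎
          where
          cancel : ω⁻¹ F.^ i F.≈ ω F.* ω⁻¹ F.^ suc i
          cancel = F.trans (F.sym (F.*-identityˡ _))
            (F.trans (F.*-congʳ (F.sym ω*ω⁻¹≈1)) (F.*-assoc ω ω⁻¹ _))

        successor : ∀ w → ∃ λ w′ → Arc w w′ × X w′ ≈ const ω * X w
        successor w with i , _ , ≡.refl ← v-surjective w =
          v j , ≡.subst (λ u → Arc u (v j)) (v-suc-predecessor i) (proj₂ (covered j)) ,
          trans (step j) (reflexive (≡.cong (λ u → const ω * X u) (v-suc-predecessor i)))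
          where j = predecessor i

      -- ζ⁻¹ is the ratio x_{v_{n-1}} / x_{v_n} on the points following C by powers of ζ.
      doubly-follows : DoublyCovered → CycleGenerator K G ω-prim C ⊆ (_≈ 0#) →
        ∀ {ζ ζ⁻¹} → ζ F.^ n F.≈ F.1# → ζ F.* ζ⁻¹ F.≈ F.1# →
        (∀ i → coefficientʸ i F.* ζ⁻¹ F.+ coefficientᶻ i F.≈ F.- ζ F.^ i) →
        X (v (n ∸ 1)) ≈ const ζ⁻¹ * X (v n) → Follows ζ
      doubly-follows covered vanish {ζ} {ζ⁻¹} ζ^n≈1 ζζ⁻¹≈1 coefficients y≈ζ⁻¹z = follows ζ^n≈1 inner
        where
        inner : ∀ i → 0 ℕ.< i → i ℕ.< n → X (v i) ≈ const (ζ F.^ i) * X (v n)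
        inner i 0<i i<n with i ℕ.≟ n ∸ 1
        -- The linear generators stop at n - 2; for index n - 1 the claim is the assumed ratio, as
        -- ζ^(n-1) = ζ⁻¹.
        ... | yes ≡.refl = trans y≈ζ⁻¹z (*-congʳ {X (v n)} (⟦⟧-cong (F.sym (inverse≈^[n-1] ζζ⁻¹≈1 ζ^n≈1))))
        ... | no  i≢n-1  = x∙y⁻¹≈ε⇒x≈y (X (v i)) (const (ζ F.^ i) * X (v n)) (trans
          (sym (doubly-linear-value {coefficientʸ i} {coefficientᶻ i} {ζ F.^ i} {ζ⁻¹} {X (v i)} y≈ζ⁻¹z (coefficients i)))
          (vanish (doubly-linear covered i 0<i i≤n-2)))
          where
          i≤n-2 : i ℕ.≤ n ∸ 2
          i≤n-2 = ≡.subst (i ℕ.≤_) (ℕ.pred[m∸n]≡m∸[1+n] n 1)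
            (ℕ.<⇒≤pred (ℕ.≤∧≢⇒< (ℕ.<⇒≤pred i<n) i≢n-1))

      directed-follows : Directed → CycleGenerator K G ω-prim C ⊆ (_≈ 0#) → Follows ω
      directed-follows directed vanish = follows ω^k≈1 inner
        where
        inner : ∀ i → 0 ℕ.< i → i ℕ.< n → X (v i) ≈ const (ω F.^ i) * X (v n)
        -- Directed generators are numbered backwards: number n - i concerns v_{n-(n-i)}, that is
        -- v_i.
        inner i 0<i i<n = ≡.subst (λ j → X (v j) ≈ const (ω F.^ j) * X (v n)) (ℕ.m∸[m∸n]≡n (ℕ.<⇒≤ i<n))
          (x∙y⁻¹≈ε⇒x≈y (X (v (n ∸ (n ∸ i)))) (const (ω F.^ (n ∸ (n ∸ i))) * X (v n))
            (vanish (directed-linear directed (n ∸ i) (ℕ.m<n⇒0<n∸m i<n) (ℕ.∸-monoʳ-≤ n 0<i))))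

      -- Generators of both kinds vanish at once. The quadratic one does so through its second
      -- factor, since x_{v_{n-1}} = ω^(n-1) x_{v_n} = ω⁻¹ x_{v_n}.
      cycle-vanishes : X (v n) ^ n ≈ 1# → Follows ω →
        ∀ {p} → CycleGenerator K G ω-prim C p → p ≈ 0#
      cycle-vanishes z^n≈1 path = vanish
        where
        y≈ω⁻¹z : X (v (n ∸ 1)) ≈ const ω⁻¹ * X (v n)
        y≈ω⁻¹z = trans (path (n ∸ 1)) (*-congʳ {X (v n)} (⟦⟧-cong (inverse≈^[n-1] ω*ω⁻¹≈1 ω^k≈1)))

        vanish : ∀ {p} → CycleGenerator K G ω-prim C p → p ≈ 0#
        vanish (doubly-linear _ i _ _) = trans
          (doubly-linear-value {coefficientʸ i} {coefficientᶻ i} {ω F.^ i} {ω⁻¹} {X (v i)} y≈ω⁻¹z (coefficients-at-ω⁻¹ i))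
          (x≈y⇒x∙y⁻¹≈ε (path i))
        vanish (doubly-quadratic _) =
          trans (*-congˡ {X (v (n ∸ 1)) - const ω * X (v n)} (x≈y⇒x∙y⁻¹≈ε y≈ω⁻¹z))
            (zeroʳ (X (v (n ∸ 1)) - const ω * X (v n)))
        vanish (directed-linear _ i _ _) = x≈y⇒x∙y⁻¹≈ε (path (n ∸ i))
        vanish power = power-generator⇐ {X (v n)} {n} z^n≈1

-- A Hamiltonian cycle from a labelling of the vertices.

-- Walking along out-neighbours realises every label, so the labelling is a
-- bijection, and its inverse lists the vertices of the cycle.
module CycleFromLabelling {n} .{{_ : NonZero n}} (2<n : 2 ℕ.< n) (G : SimpleDigraph n) (label : Fin n → Fin n)
  (next : ∀ i → ∃ λ j → SimpleDigraph.Arc G i j × toℕ (label j) ≡ suc (toℕ (label i)) % n) where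

  open SimpleDigraph G

  private
    start : Fin n
    start = 0 mod n

    walk : ℕ → Fin n
    walk zero    = start
    walk (suc k) = proj₁ (next (walk k))

    suc-% : ∀ m → suc (m % n) % n ≡ suc m % n
    suc-% m = ≡.trans (%-distribˡ-+ 1 (m % n) n)
      (≡.trans (≡.cong (λ k → (1 % n ℕ.+ k) % n) (m%n%n≡m%n m n)) (≡.sym (%-distribˡ-+ 1 m n)))

    label-walk : ∀ k → toℕ (label (walk k)) ≡ (toℕ (label start) ℕ.+ k) % n
    label-walk zero    = ≡.sym (≡.trans (≡.cong (_% n) (ℕ.+-identityʳ _)) (m<n⇒m%n≡m (toℕ<n (label start))))
    label-walk (suc k) = ≡.trans (proj₂ (proj₂ (next (walk k))))
      (≡.trans (≡.cong (λ m → suc m % n) (label-walk k))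
      (≡.trans (suc-% (toℕ (label start) ℕ.+ k)) (≡.cong (_% n) (≡.sym (ℕ.+-suc _ k)))))

    -- The walk begins at an arbitrary vertex. The offset n - `label start` cancels its label modulo
    -- n, so that position r carries label r.
    vertex : Fin n → Fin n
    vertex r = walk (n ∸ toℕ (label start) ℕ.+ toℕ r)

    label-vertex : ∀ r → label (vertex r) ≡ r
    label-vertex r = toℕ-injective (≡.trans (label-walk (n ∸ s ℕ.+ toℕ r))
      (≡.trans (≡.cong (_% n) rotation) (≡.trans ([m+n]%n≡m%n (toℕ r) n) (m<n⇒m%n≡m (toℕ<n r)))))
      where
      s = toℕ (label start)

      rotation : s ℕ.+ (n ∸ s ℕ.+ toℕ r) ≡ toℕ r ℕ.+ n
      rotation = ≡.trans (≡.sym (ℕ.+-assoc s (n ∸ s) (toℕ r)))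
        (≡.trans (≡.cong (ℕ._+ toℕ r) (ℕ.m+[n∸m]≡n (ℕ.<⇒≤ (toℕ<n (label start))))) (ℕ.+-comm n (toℕ r)))

    label-vertex-mod : ∀ i → toℕ (label (vertex (i mod n))) ≡ i % n
    label-vertex-mod i = ≡.trans (≡.cong toℕ (label-vertex (i mod n))) (toℕ-mod i n)

    vertex-injective : ∀ {r s} → vertex r ≡ vertex s → r ≡ s
    vertex-injective {r} {s} eq =
      ≡.trans (≡.sym (label-vertex r)) (≡.trans (≡.cong label eq) (label-vertex s))

    -- A right inverse of `label` is injective, hence surjective on a finite set, hence also a left
    -- inverse.
    vertex-label : ∀ w → vertex (label w) ≡ w
    vertex-label w with r , ≡.refl ← injective⇒surjective vertex-injective w =
      ≡.cong vertex (label-vertex r)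

    -- The out-neighbour given by `next` has the label of the next position, and a vertex is
    -- determined by its label.
    vertex-arc : ∀ i → Arc (vertex (i mod n)) (vertex (suc i mod n))
    vertex-arc i with j , arc , eq ← next (vertex (i mod n)) =
      ≡.subst (Arc (vertex (i mod n)))
        (≡.trans (≡.sym (vertex-label j)) (≡.cong vertex (toℕ-injective label-j))) arc
      where
      label-j : toℕ (label j) ≡ toℕ (suc i mod n)
      label-j = ≡.trans eq
        (≡.trans (≡.cong (λ m → suc m % n) (label-vertex-mod i))
        (≡.trans (suc-% i) (≡.sym (toℕ-mod (suc i) n))))

  cycle : HamiltonianCycle G
  cycle = record { 2<k = 2<n ; vertices = vertex ; distinct = vertex-injective ; arcs = vertex-arc }

  label-v : ∀ i → toℕ (label (Cycle.v cycle i)) ≡ i % n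
  label-v = label-vertex-mod

-- The inclusion of the Hamiltonian ideal in the cycle ideals.

module _ {c ℓ₁ ℓ₂} (K : HeytingField c ℓ₁ ℓ₂) {n : ℕ} (G : SimpleDigraph n)
  {ω : HeytingField.Carrier K} (ω-prim : IsPrimitiveRoot K n ω) where

  private
    module F where
      open CommutativeRing (fieldRing K) public
      open Exponentiation semiring public

  open SimpleDigraph G
  open IsPrimitiveRoot ω-prim
  open Polynomials (fieldRing K) n
  open PolynomialQuotient (fieldRing K) n
    using (quotient; const-isRingHomomorphism; ∈⇒∼0; ∼0⇒∈)

  hamiltonian⊆cycle : ∀ C → hamiltonianIdeal K G ω ⊆ cycleIdeal K G ω-prim C
  hamiltonian⊆cycle C p∈ = ∼0⇒∈ S (generated-⊆ vanish p∈)
    where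
    open Cycle C
    open CycleProperties C
    open RootOfUnity K 2<k ω-prim using (ω⁻¹; ω-invertible)
    open PrimitiveRoot K 2<k ω-prim

    S : Pred Poly c
    S = CycleGenerator K G ω-prim C

    open CommutativeRing (quotient S)
    open QuotientProperties K S
    open Exponentiation semiring
    open Factorization (quotient S)
    open RingSolver (quotient S)

    z^n≈1 : X (v n) ^ n ≈ 1#
    z^n≈1 = power-generator⇒ {X (v n)} {n} (∈⇒∼0 S (generator power))

    factor : F.Carrier → Poly
    factor ζ⁻¹ = X (v (n ∸ 1)) - const ζ⁻¹ * X (v n)

    -- Adjoining a factor of the quadratic generator fixes x_{v_{n-1}} = ζ⁻¹ x_{v_n}, and the linear
    -- generators then yield `Follows ζ`. The vanishing obtained in this larger quotient comes back
    -- as divisibility in the original one; `path-vanishes` stands for `forward-vanishes` or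
    -- `backward-vanishes`.
    factor-∣ : DoublyCovered → ∀ {ζ ζ⁻¹} → ζ F.^ n F.≈ F.1# → ζ F.* ζ⁻¹ F.≈ F.1# →
      (∀ i → coefficientʸ i F.* ζ⁻¹ F.+ coefficientᶻ i F.≈ F.- ζ F.^ i) →
      (let module Q = QuotientProperties K (S ∪ ｛ factor ζ⁻¹ ｝)
           module A = CommutativeRing (quotient (S ∪ ｛ factor ζ⁻¹ ｝))
           module E = Exponentiation A.semiring in
       X (v n) E.^ n A.≈ A.1# → Q.Follows C ω-prim ζ →
       ∀ {p} → HamiltonianGenerator K G ω p → p A.≈ A.0#) →
      ∀ {p} → HamiltonianGenerator K G ω p → factor ζ⁻¹ ∣ʳ p
    factor-∣ covered {ζ} {ζ⁻¹} ζ^n≈1 ζζ⁻¹≈1 coefficients path-vanishes p∈ =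
      ∈⇒∣ (∼0⇒∈ T (path-vanishes z^n≈1′ (Q.doubly-follows C ω-prim covered
        (λ q∈ → ∈⇒∼0 T (generator (inj₁ q∈))) ζ^n≈1 ζζ⁻¹≈1 coefficients y≈ζ⁻¹z) p∈))
      where
      T = S ∪ ｛ factor ζ⁻¹ ｝
      module Q = QuotientProperties K T
      module A = CommutativeRing (quotient T)
      module E = Exponentiation A.semiring

      z^n≈1′ : X (v n) E.^ n A.≈ A.1#
      z^n≈1′ = Q.power-generator⇒ {X (v n)} {n} (∈⇒∼0 T (generator (inj₁ power)))

      y≈ζ⁻¹z : X (v (n ∸ 1)) A.≈ const ζ⁻¹ A.* X (v n)
      y≈ζ⁻¹z = RingProperties.x∙y⁻¹≈ε⇒x≈y A.ring (X (v (n ∸ 1))) (const ζ⁻¹ A.* X (v n))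
        (∈⇒∼0 T (generator (inj₂ ≡.refl)))

    z-unit : Unit (X (v n))
    z-unit = unit-root 2<k z^n≈1
      where
      unit-root : ∀ {m} → 2 ℕ.< m → X (v n) ^ m ≈ 1# → Unit (X (v n))
      unit-root {suc m} _ eq = X (v n) ^ m , trans (*-comm (X (v n) ^ m) (X (v n))) eq

    -- The factors differ by -(ω - ω⁻¹) x_{v_n}, where x_{v_n} is a unit because its n-th power is
    -- 1.
    factors-comaximal : Comaximal (factor ω) (factor ω⁻¹)
    factors-comaximal = unit-difference⇒comaximal (unit-cong difference
      (unit-neg (unit-* (const-unit ω-ω⁻¹-unit) z-unit)))
      where
      difference : - (const (ω F.- ω⁻¹) * X (v n)) ≈ factor ω - factor ω⁻¹
      difference = trans (-‿cong (*-congʳ {X (v n)} (const-difference ω ω⁻¹)))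
        (solve 4 (λ y z a b → :- ((a :- b) :* z) := (y :- a :* z) :- (y :- b :* z)) refl
          (X (v (n ∸ 1))) (X (v n)) (const ω) (const ω⁻¹))

    vanish : ∀ {p} → HamiltonianGenerator K G ω p → p ≈ 0#
    vanish p∈ with doublyCovered?
    ... | no  directed = forward-vanishes C ω-prim z^n≈1
            (directed-follows C ω-prim directed (λ q∈ → ∈⇒∼0 S (generator q∈))) p∈
    ... | yes covered  = 0∣⇒≈0 (∈⇒∼0 S (generator (doubly-quadratic covered)))
            (comaximal-∣ factors-comaximal
              -- A factor is named after the ratio ζ⁻¹, so `factor ω` belongs to ζ = ω⁻¹, the
              -- backward case, and `factor ω⁻¹` to the forward case.
              (factor-∣ covered ω⁻¹^n≈1 (proj₁ (proj₂ ω-invertible)) coefficients-at-ω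
                (QuotientProperties.backward-vanishes K _ C ω-prim covered) p∈)
              (factor-∣ covered ω^k≈1 ω*ω⁻¹≈1 coefficients-at-ω⁻¹
                (QuotientProperties.forward-vanishes K _ C ω-prim) p∈))

  -- The reverse inclusion: splitting off the coordinates one by one.

  module _ (2<n : 2 ℕ.< n) where

    open PrimitiveRoot K 2<n ω-prim using (power-difference-unit; incongruent-difference-unit; ^-%)

    private instance
      n-nonZero : NonZero n
      n-nonZero = ℕ.>-nonZero (ℕ.<-trans (ℕ.s≤s ℕ.z≤n) 2<n)

    coordinate : (Fin n → Fin n) → Fin n → Poly
    coordinate label i = RawRing._+_ polyRawRing (X i) (RawRing.-_ polyRawRing (const (ω F.^ toℕ (label i))))

    -- A partial labelling is encoded by a total `label` and the list `is` of vertices on which x_i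
    -- = ω^(label i) is imposed.
    Restricted : List (Fin n) → (Fin n → Fin n) → Pred Poly c
    Restricted is label = HamiltonianGenerator K G ω ∪ λ p → ∃ λ i → i ∈ is × coordinate label i ≡ p

    update : Fin n → Fin n → (Fin n → Fin n) → Fin n → Fin n
    update i a label j with j ≟ᶠ i
    ... | yes _ = a
    ... | no  _ = label j

    -- This is `root-split` at x = x_i and ζ = ω in the quotient by `S`, where x_i^n = 1 comes from
    -- the power generators of H_G.
    split-coordinate : ∀ {S : Pred Poly c} {i f} → HamiltonianGenerator K G ω ⊆ S →
      (∀ (a : Fin n) → Ideal polyRawRing (S ∪ ｛ coordinate (λ _ → a) i ｝) f) →
      Ideal polyRawRing S f
    split-coordinate {S} {i} {f} H⊆S f∈ = ∼0⇒∈ S (root-split (ℕ.<-trans (ℕ.s≤s ℕ.z≤n) 2<n)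
      (trans (sym (const-^ ω n)) (⟦⟧-cong ω^k≈1))
      (λ {j} {k} j<k k<n → unit-cong
        (trans (const-difference (ω F.^ j) (ω F.^ k)) (+-cong (const-^ ω j) (-‿cong (const-^ ω k))))
        (const-unit (power-difference-unit j<k k<n)))
      (power-generator⇒ {X i} {n} (∈⇒∼0 S (generator (H⊆S (power i)))))
      factor-∣)
      where
      open CommutativeRing (quotient S)
      open IsRingHomomorphism (const-isRingHomomorphism S) using (⟦⟧-cong)
      open QuotientProperties K S
      open Exponentiation semiring
      open Factorization (quotient S)

      factor-∣ : ∀ {k} → k ℕ.< n → X i - const ω ^ k ∣ʳ f
      factor-∣ {k} k<n with q , eq ← ∈⇒∣ (f∈ (fromℕ< k<n)) =
        q , trans (*-congˡ {q} (+-congˡ {X i} (-‿cong (trans (sym (const-^ ω k))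
              (reflexive (≡.cong (λ m → const (ω F.^ m)) (≡.sym (toℕ-fromℕ< k<n)))))))) eq

    -- Every occurrence of `i` in the list gets the new label `a`, which is the adjoined generator;
    -- any other vertex lies in the tail and keeps its label.
    restricted-⊆ : ∀ i a is label → Restricted (i ∷ is) (update i a label) ⊆
      Ideal polyRawRing (Restricted is label ∪ ｛ coordinate (λ _ → a) i ｝)
    restricted-⊆ i a is label (inj₁ p∈) = generator (inj₁ (inj₁ p∈))
    restricted-⊆ i a is label (inj₂ (j , j∈ , ≡.refl)) with j ≟ᶠ i | j∈
    ... | yes ≡.refl | _         = generator (inj₂ ≡.refl)
    ... | no  j≢i    | here j≡i  = contradiction j≡i j≢i
    ... | no  j≢i    | there j∈′ = generator (inj₁ (inj₂ (j , j∈′ , ≡.refl)))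

    -- Induction on the list: for each `a`, the hypothesis at `update i a label` supplies one of the
    -- n memberships that `split-coordinate` combines.
    split-coordinates : ∀ {f} is → (∀ label → Ideal polyRawRing (Restricted is label) f) →
      hamiltonianIdeal K G ω f
    -- No coordinate is imposed for the empty list; `id` is an arbitrary choice of labelling.
    split-coordinates []       f∈ = ∼0⇒∈ _ (QuotientProperties.generated-⊆ K _
      (λ { (inj₁ p∈) → ∈⇒∼0 _ (generator p∈) ; (inj₂ (_ , () , _)) }) (f∈ id))
    split-coordinates (i ∷ is) f∈ = split-coordinates is λ label →
      split-coordinate {i = i} inj₁ λ a → ∼0⇒∈ _ (QuotientProperties.generated-⊆ K _
        (λ p∈ → ∈⇒∼0 _ (restricted-⊆ i a is label p∈)) (f∈ (update i a label)))

    -- The quotient belonging to a full labelling.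

    module _ (label : Fin n → Fin n) where

      private
        T : Pred Poly c
        T = Restricted (allFin n) label

      open CommutativeRing (quotient T)
      open IsRingHomomorphism (const-isRingHomomorphism T) using (⟦⟧-cong; *-homo)
      open QuotientProperties K T
      open Factorization (quotient T)
      open RingProperties ring using (x∙y⁻¹≈ε⇒x≈y)
      open SetoidReasoning setoid

      X≈ : ∀ i → X i ≈ const (ω F.^ toℕ (label i))
      X≈ i = x∙y⁻¹≈ε⇒x≈y (X i) (const (ω F.^ toℕ (label i)))
        (∈⇒∼0 T (generator (inj₂ (i , ∈-allFin i , ≡.refl))))

      Successor : Fin n → Fin n → Set
      Successor i j = Arc i j × toℕ (label j) ≡ suc (toℕ (label i)) % n

      -- Each factor of the product at `i` becomes ω^(label i + 1) - ω^(label j) with incongruent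
      -- exponents, hence a unit. A product of units that vanishes makes the whole quotient zero.
      dead-end : ∀ {i} → ¬ ∃ (Successor i) → ∀ f → f ≈ 0#
      dead-end {i} stuck f = unit-cancel (product-unit (All.map⁺ (All.tabulate factor-unit)))
        (trans (*-congʳ {f} (∈⇒∼0 T (generator (inj₁ (product i))))) (zeroˡ f))
        where
        factor-unit : ∀ {j} → j ∈ δ⁺ i → Unit (const ω * X i - X j)
        factor-unit {j} j∈ = unit-cong difference (const-unit (incongruent-difference-unit
          (suc (toℕ (label i))) (toℕ (label j))
          λ eq → stuck (j , proj₂ (∈-filter⁻ (arc? i) {xs = allFin n} j∈) ,
            ≡.trans (≡.sym (m<n⇒m%n≡m (toℕ<n (label j)))) (≡.sym eq))))
          where
          difference : const (ω F.^ suc (toℕ (label i)) F.- ω F.^ toℕ (label j)) ≈ const ω * X i - X j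
          difference = begin
            const (ω F.^ suc (toℕ (label i)) F.- ω F.^ toℕ (label j))
              ≈⟨ const-difference (ω F.^ suc (toℕ (label i))) (ω F.^ toℕ (label j)) ⟩
            const (ω F.^ suc (toℕ (label i))) - const (ω F.^ toℕ (label j))
              ≈⟨ +-congʳ { - const (ω F.^ toℕ (label j))} (*-homo ω (ω F.^ toℕ (label i))) ⟩
            const ω * const (ω F.^ toℕ (label i)) - const (ω F.^ toℕ (label j))
              ≈⟨ +-cong (*-congˡ {const ω} (X≈ i)) (-‿cong (X≈ j)) ⟨
            const ω * X i - X j ∎

      -- On the cycle built from the labels, v_i has label i modulo n, so x_{v_i} = ω^i and x_{v_n}
      -- = 1, which gives `Follows ω`.
      on-cycle : (∀ i → ∃ (Successor i)) → ∃ λ C → ∀ {f} → cycleIdeal K G ω-prim C f → f ≈ 0#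
      on-cycle next = cycle , generated-⊆ (cycle-vanishes cycle ω-prim
        (power-generator⇒ {X (v n)} {n} (∈⇒∼0 T (generator (inj₁ (power (v n)))))) path)
        where
        open CycleFromLabelling 2<n G label next
        open Cycle cycle using (v)

        X-v : ∀ i → X (v i) ≈ const (ω F.^ i)
        X-v i = trans (X≈ (v i)) (⟦⟧-cong (F.trans (F.reflexive (≡.cong (ω F.^_) (label-v i))) (^-% ω^k≈1 i)))

        path : ∀ i → X (v i) ≈ const (ω F.^ i) * X (v n)
        path i = begin
          X (v i)                      ≈⟨ X-v i ⟩
          const (ω F.^ i)              ≈⟨ *-identityʳ (const (ω F.^ i)) ⟨
          const (ω F.^ i) * 1#         ≈⟨ *-congˡ {const (ω F.^ i)} (trans (X-v n) (⟦⟧-cong ω^k≈1)) ⟨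
          const (ω F.^ i) * X (v n)    ∎

      successor? : ∀ i → Dec (∃ (Successor i))
      successor? i = any? λ j → arc? i j ×-dec (toℕ (label j) ℕ.≟ suc (toℕ (label i)) % n)

      -- Arcs are decidable and vertices finite in number, so either the cycle or an explicit dead
      -- end can be found.
      restricted-member : ∀ {f} → (∀ C → cycleIdeal K G ω-prim C f) → f ≈ 0#
      restricted-member {f} f∈ with all? successor?
      ... | yes next  = let C , vanish = on-cycle next in vanish (f∈ C)
      ... | no  ¬next with i , stuck ← ¬∀⟶∃¬ n _ successor? ¬next = dead-end stuck f

    cycles⊆hamiltonian : ⋂ (HamiltonianCycle G) (cycleIdeal K G ω-prim) ⊆ hamiltonianIdeal K G ω
    cycles⊆hamiltonian f∈ = split-coordinates (allFin n) λ label →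
      ∼0⇒∈ (Restricted (allFin n) label) (restricted-member label f∈)

theorem3p9 :
    ∀ {c ℓ₁ ℓ₂} (K : HeytingField c ℓ₁ ℓ₂) → AlgebraicallyClosed K →
    (n : ℕ) → n ≥ 3 → (G : SimpleDigraph n) → Connected G →
    (∀ p → IsCharacteristic K p → ¬ (p ∣ n)) →
    (ω : HeytingField.Carrier K) (ω-prim : IsPrimitiveRoot K n ω) →
    hamiltonianIdeal K G ω ≐ ⋂ (HamiltonianCycle G) (cycleIdeal K G ω-prim)
theorem3p9 K _ n n≥3 G _ _ ω ω-prim =
  (λ f∈ C → hamiltonian⊆cycle K G ω-prim C f∈) , cycles⊆hamiltonian K G ω-prim n≥3
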